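{- Let $Y$ be an alphabet. Every recognisable set of series-parallel graphs over $Y$ is regular; that is, for every Petri automaton $\mathcal A$ over $Y$ there exists a simple expression $e$ over $Y$ such that $\mathcal G(e)=\mathcal G(\mathcal A)$.
   Context: A graph over $Y$ is a tuple $\langle V,E,\iota,o\rangle$ with $V$ finite, $E\subseteq V\times Y\times V$, and $\iota,o\in V$ (input, output); graphs are considered up to isomorphism. Simple expressions over $Y$: $e,f::=e\cup f\mid e\cdot f\mid e\cap f\mid e^+\mid 0\mid a$ ($a\in Y$). Simple terms are simple expressions using only $\cdot$, $\cap$ and letters. The set of terms $T(e)$: $T(a)=\{a\}$, $T(0)=\emptyset$, $T(e\cup f)=T(e)\cup T(f)$, $T(e\cdot f)=\{u\cdot v\mid u\in T(e),v\in T(f)\}$, $T(e\cap f)=\{u\cap v\mid u\in T(e),v\in T(f)\}$, $T(e^+)=\bigcup_{n>0}\{u_1\cdots u_n\mid u_i\in T(e)\}$. The graph $\mathcal G(u)$ of a simple term: $\mathcal G(a)$ is a single edge labelled $a$ from input to (distinct) output; $\mathcal G(u\cdot v)$ is series composition (merge output of $\mathcal G(u)$ with input of $\mathcal G(v)$); $\mathcal G(u\cap v)$ is parallel composition (merge inputs, merge outputs). $\mathcal G(e)=\{\mathcal G(u)\mid u\in T(e)\}$. A set of graphs over $Y$ is a regular set of series-parallel graphs if it equals $\mathcal G(e)$ for some simple expression $e$; it is recognisable if it equals $\mathcal G(\mathcal A)$ for some Petri automaton $\mathcal A$ over $Y$. Series-parallel graphs: on graphs with edges labelled by simple terms, the SP-rewriting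 system has two rules: (parallel) replace two edges $(x,u,y),(x,v,y)$ by the single edge $(x,u\cap v,y)$; (series) if $w$ is neither the input nor the output and its only adjacent edges are $(x,u,w)$ and $(w,v,y)$, delete $w$ and these edges and add $(x,u\cdot v,y)$. A graph is series-parallel if it rewrites in some number of steps to a graph consisting of two distinct vertices, the input and the output, and exactly one edge, from input to output. A Petri automaton over $Y$ is $\mathcal A=\langle P,\mathcal T,\iota\rangle$ with $P$ a finite set of places, $\mathcal T\subseteq\mathcal P(P)\times\mathcal P(Y\times P)$ a finite set of transitions $t=\langle \mathrm{in}(t),\mathrm{out}(t)\rangle$ with $\mathrm{in}(t)\neq\emptyset$, each $\mathrm{out}(t)$ being finite, and $\iota\in P$ the initial place, subject to the two constraints below. Let $\pi_2(\mathrm{out}(t))=\{p\mid\exists a,(a,p)\in\mathrm{out}(t)\}$. A state is a set $S\subseteq P$; $t$ is enabled in $S$ if $\mathrm{in}(t)\subseteq S$, and then firing $t$ leads from $S$ to $S'=(S\setminus\mathrm{in}(t))\cup\pi_2(\mathrm{out}(t))$. A run from $S_0$ to $S_{n+1}$ is a sequence $t_0;\dots;t_n$ of successively fired transitions; it is accepting if it goes from $\{\iota\}$ to $\emptyset$. A state is reachable if there is a run to it from $\{\iota\}$. The trace $\mathcal G(R)$ of an accepting run $R=t_0;\dots;t_n$ is the graph with vertices $\{0,\dots,n\}$, input $0$, output $n$, and edges $(k,a,l)$ whenever there is $(a,p)\in\mathrm{out}(t_k)$ with $l=\min\{l'>k\mid p\in\mathrm{in}(t_{l'})\}$. $\mathcal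 G(\mathcal A)$ is the set of traces of accepting runs of $\mathcal A$. Constraint 1 (safety): whenever $t$ is enabled in a reachable state $S$, $(S\setminus\mathrm{in}(t))\cap\pi_2(\mathrm{out}(t))=\emptyset$. Constraint 2: every graph in $\mathcal G(\mathcal A)$ is series-parallel. -}

module Defs where

open import Data.Fin using (Fin; zero; suc; fromℕ; punchIn; punchOut; _↑ˡ_; _↑ʳ_; _<_)
open import Data.Fin.Subset as Subset using (Subset; ⁅_⁆; Nonempty)
open import Data.List using (List; map)
import Data.List.Membership.Propositional as List
open import Data.Nat using (ℕ; zero; suc; _+_)
open import Data.Product using (Σ-syntax; ∃; ∃-syntax; _×_; _,_; proj₂)
open import Data.Vec using (Vec; []; _∷_; lookup)
open import Function using (_∘_; _↔_; _⇔_; Inverse)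
open import Level using (0ℓ)
open import Relation.Binary.Construct.Closure.ReflexiveTransitive using (Star)
open import Relation.Binary.PropositionalEquality using (_≡_; _≢_)
open import Relation.Unary as Pred using (Pred; _∈_; _∉_; _⊆_; _≐_; ｛_｝)

private
  variable
    Y Z : Set
    n k : ℕ

------------------------------------------------------------------------
-- Graphs

Edges : Set → ℕ → Set₁
Edges Y n = Pred (Fin n × Y × Fin n) 0ℓ

record Graph (Y : Set) : Set₁ where
  constructor graph
  field
    size   : ℕ
    edges  : Edges Y size
    input  : Fin size
    output : Fin size

open Graph public

record _≅_ (G H : Graph Y) : Set where
  field
    vertices : Fin (size G) ↔ Fin (size H)

  open Inverse vertices public using (to; from)

  field
    edge-⇔   : ∀ x a y → (x , a , y) ∈ edges G ⇔ (to x , a , to y) ∈ edges H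
    input-≡  : to (input G) ≡ input H
    output-≡ : to (output G) ≡ output H

infix 4 _≅_

image : (Fin n → Fin k) → (Y → Z) → Edges Y n → Edges Z k
image f g E (x , b , y) =
  ∃[ x′ ] ∃[ a ] ∃[ y′ ] ((x′ , a , y′) ∈ E × f x′ ≡ x × g a ≡ b × f y′ ≡ y)

relabel : (Y → Z) → Graph Y → Graph Z
relabel g (graph n E i o) = graph n (image (λ x → x) g E) i o

------------------------------------------------------------------------
-- Simple terms and simple expressions

data Term (Y : Set) : Set where
  letter  : Y → Term Y
  _·_ _∩_ : Term Y → Term Y → Term Y

data Expr (Y : Set) : Set where
  letter      : Y → Expr Y
  𝟎           : Expr Y
  _∪_ _·_ _∩_ : Expr Y → Expr Y → Expr Y
  _⁺          : Expr Y → Expr Y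

infixr 7 _·_
infixr 6 _∩_
infixr 5 _∪_
infix  8 _⁺

-- The products u₁ · (u₂ · (⋯ · uₙ)) with n > 0 and every uᵢ in L.  The
-- bracketing is immaterial, since it does not affect the graph of the
-- product up to isomorphism.
data Products (L : Pred (Term Y) 0ℓ) : Pred (Term Y) 0ℓ where
  [_] : ∀ {u} → u ∈ L → u ∈ Products L
  _∷_ : ∀ {u v} → u ∈ L → v ∈ Products L → u · v ∈ Products L

terms : Expr Y → Pred (Term Y) 0ℓ
terms (letter a) = ｛ letter a ｝
terms 𝟎          = Pred.∅
terms (e ∪ f)    = terms e Pred.∪ terms f
terms (e · f) t  = ∃[ u ] ∃[ v ] (u ∈ terms e × v ∈ terms f × t ≡ u · v)
terms (e ∩ f) t  = ∃[ u ] ∃[ v ] (u ∈ terms e × v ∈ terms f × t ≡ u ∩ v)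
terms (e ⁺)      = Products (terms e)

------------------------------------------------------------------------
-- The graph of a simple term
--
-- Its vertices are Fin (2 + k): vertex 0 is the input, vertex 1 the output,
-- and k is the number of remaining (inner) vertices.

inner : Term Y → ℕ
inner (letter a) = 0
inner (u · v)    = suc (inner u + inner v)
inner (u ∩ v)    = inner u + inner v

pattern source = zero
pattern sink   = suc zero

place : Fin n → Fin n → (Fin k → Fin n) → Fin (2 + k) → Fin n
place i o f source        = i
place i o f sink          = o
place i o f (suc (suc x)) = f x

-- Vertex 2 of the series composition is the merged vertex.
termEdges : (u : Term Y) → Edges Y (2 + inner u)
termEdges (letter a) = ｛ source , a , sink ｝
termEdges (u · v) =
         image (place source middle (λ x → 3 ↑ʳ (x ↑ˡ inner v))) (λ a → a) (termEdges u)
  Pred.∪ image (place middle sink   (λ x → 3 ↑ʳ (inner u ↑ʳ x))) (λ a → a) (termEdges v)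
  where
  middle : Fin (3 + (inner u + inner v))
  middle = suc (suc zero)
termEdges (u ∩ v) =
         image (place source sink (λ x → 2 ↑ʳ (x ↑ˡ inner v))) (λ a → a) (termEdges u)
  Pred.∪ image (place source sink (λ x → 2 ↑ʳ (inner u ↑ʳ x))) (λ a → a) (termEdges v)

termGraph : Term Y → Graph Y
termGraph u = graph (2 + inner u) (termEdges u) source sink

-- 𝒢ₑ and traces are closed under isomorphism, so that _≐_ compares them as
-- sets of graphs up to isomorphism.
GraphSet : Set → Set₁
GraphSet Y = Pred (Graph Y) 0ℓ

𝒢ₑ : Expr Y → GraphSet Y
𝒢ₑ e G = ∃[ u ] (u ∈ terms e × G ≅ termGraph u)

------------------------------------------------------------------------
-- Series-parallel graphs

data _⟶_ {Y : Set} : Graph (Term Y) → Graph (Term Y) → Set₁ where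

  -- F is the set of the edges that are left untouched.
  parallel : ∀ {n} {E : Edges (Term Y) n} {i o} x y u v (F : Edges (Term Y) n) →
    u ≢ v →
    (x , u , y) ∉ F →
    (x , v , y) ∉ F →
    E ≐ F Pred.∪ ｛ x , u , y ｝ Pred.∪ ｛ x , v , y ｝ →
    graph n E i o ⟶ graph n (F Pred.∪ ｛ x , u ∩ v , y ｝) i o

  -- The vertices other than w are indexed by Fin n through punchIn w.
  series : ∀ {n} {E : Edges (Term Y) (suc n)} {i o} w (x y : Fin n) u v →
    (w≢i : w ≢ i) (w≢o : w ≢ o) →
    (∀ z t → (z , t , w) ∈ E ⇔ (z ≡ punchIn w x × t ≡ u)) →
    (∀ z t → (w , t , z) ∈ E ⇔ (z ≡ punchIn w y × t ≡ v)) →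
    graph (suc n) E i o ⟶
    graph n
      ((λ (p , t , q) → (punchIn w p , t , punchIn w q) ∈ E) Pred.∪ ｛ x , u · v , y ｝)
      (punchOut w≢i) (punchOut w≢o)

infix 4 _⟶_

SingleEdge : Graph Y → Set
SingleEdge G =
  size G ≡ 2 × input G ≢ output G × ∃[ a ] edges G ≐ ｛ input G , a , output G ｝

SeriesParallel : Graph Y → Set₁
SeriesParallel G = ∃[ H ] (Star _⟶_ (relabel letter G) H × SingleEdge H)

------------------------------------------------------------------------
-- Petri automata

-- The finite set of outputs is given by a list, of which only the membership
-- relation matters; likewise for the set of transitions of a net.
record Transition (Y : Set) (n : ℕ) : Set where
  field
    inputs   : Subset n
    outputs  : List (Y × Fin n)
    nonempty : Nonempty inputs

  outputPlaces : Subset n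
  outputPlaces = Subset.⋃ (map (⁅_⁆ ∘ proj₂) outputs)

open Transition public

record Net (Y : Set) : Set where
  field
    places      : ℕ
    transitions : List (Transition Y places)
    initial     : Fin places

Enabled : Transition Y n → Subset n → Set
Enabled t S = inputs t Subset.⊆ S

fire : Transition Y n → Subset n → Subset n
fire t S = (S Subset.─ inputs t) Subset.∪ outputPlaces t

-- The last three conditions say that l is the first transition after k that
-- consumes the token put in p.
traceEdges : Vec (Transition Y n) k → Edges Y k
traceEdges ts (k , a , l) = ∃[ p ]
  ( (a , p) List.∈ outputs (lookup ts k)
  × k < l
  × p Subset.∈ inputs (lookup ts l)
  × (∀ l′ → k < l′ → l′ < l → p Subset.∉ inputs (lookup ts l′)))

trace : Vec (Transition Y n) (suc k) → Graph Y
trace {k = k} ts = graph (suc k) (traceEdges ts) zero (fromℕ k)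

module _ (N : Net Y) where
  open Net N

  State : Set
  State = Subset places

  data Run : State → Vec (Transition Y places) k → State → Set where
    []  : ∀ {S} → Run S [] S
    _∷_ : ∀ {S S′ t} {ts : Vec (Transition Y places) k} →
          t List.∈ transitions × Enabled t S →
          Run (fire t S) ts S′ →
          Run S (t ∷ ts) S′

  Reachable : State → Set
  Reachable S = ∃[ k ] Σ[ ts ∈ Vec _ k ] Run ⁅ initial ⁆ ts S

  Accepting : Vec (Transition Y places) k → Set
  Accepting ts = Run ⁅ initial ⁆ ts Subset.⊥

  traces : GraphSet Y
  traces G = ∃[ k ] Σ[ ts ∈ Vec _ (suc k) ] (Accepting ts × G ≅ trace ts)

  Safe : Set
  Safe = ∀ S t → Reachable S → t List.∈ transitions → Enabled t S →
         (S Subset.─ inputs t) Subset.∩ outputPlaces t ≡ Subset.⊥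

record PetriAutomaton (Y : Set) : Set₁ where
  field
    net            : Net Y
    safe           : Safe net
    seriesParallel : traces net ⊆ SeriesParallel

𝒢ₐ : PetriAutomaton Y → GraphSet Y
𝒢ₐ 𝒜 = traces (PetriAutomaton.net 𝒜)

{-# OPTIONS --safe #-}
module Submission where

import Data.Bool.Properties as Bool
open import Data.Bool using (if_then_else_)
open import Data.Empty using (⊥-elim)
open import Data.Fin using (Fin; zero; suc; fromℕ; punchIn; punchOut; splitAt; _↑ˡ_; _↑ʳ_; _<_)
open import Data.Fin.Properties
  using (_≟_; <-cmp; punchIn-injective; punchInᵢ≢i; punchIn-punchOut; splitAt-↑ˡ; splitAt-↑ʳ)
open import Data.Fin.Subset as Subset using (Subset; ⁅_⁆; Nonempty; inside; outside)
open import Data.Fin.Subset.Properties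
  using (_∈?_; ∉⊥; ⊥⊆; ⊆-antisym; ∣p∣≤n; p⊂q⇒∣p∣<∣q∣; x∈⁅x⁆; x∈⁅y⁆⇒x≡y; x∈p∩q⁺; x∈p∩q⁻;
         x∈p∪q⁺; x∈p∪q⁻; ∪-assoc; ∪-comm; ∪-identityˡ; x∈p∧x∉q⇒x∈p─q; p─q⊆p)
open import Data.List as List
  using (List; []; _∷_; _++_; map; filter; concatMap; length; tabulate; allFin;
         cartesianProduct; cartesianProductWith)
open import Data.List.Membership.Propositional using (_∈_; _∉_)
open import Data.List.Membership.Propositional.Properties
  using (∈-map⁺; ∈-map⁻; ∈-filter⁺; ∈-filter⁻; ∈-tabulate⁺; ∈-tabulate⁻; ∈-allFin;
         ∈-cartesianProduct⁺; ∈-cartesianProductWith⁺)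
open import Data.List.Properties using (++-assoc; ++-identityʳ; tabulate-cong; tabulate-lookup)
open import Data.List.Relation.Binary.Permutation.Propositional
  using (_↭_; refl; prep; swap; trans; ↭-refl; ↭-reflexive; ↭-sym; ↭-trans; ↭⇒↭ₛ;
         module PermutationReasoning)
open import Data.List.Relation.Binary.Permutation.Propositional.Properties
  using (++⁺; ++⁺ˡ; ++⁺ʳ; shift; shifts; ∷↭∷ʳ; ∈-resp-↭; Any-resp-↭; All-resp-↭)
import Data.List.Relation.Binary.Permutation.Setoid.Properties as Permutation
open import Data.List.Relation.Unary.All as All using (All; []; _∷_)
import Data.List.Relation.Unary.All.Properties as All
open import Data.List.Relation.Unary.AllPairs using (AllPairs; []; _∷_)
open import Data.List.Relation.Unary.Any as Any using (Any; here; there)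
import Data.List.Relation.Unary.Any.Properties as Any
open import Data.List.Relation.Unary.Unique.Propositional using (Unique)
import Data.List.Relation.Unary.Unique.Propositional.Properties as Unique
open import Data.Nat as ℕ using (ℕ; zero; suc; _+_; _≤_; s≤s; z≤n)
open import Data.Nat.Properties
  using (+-suc; +-identityʳ; +-monoʳ-≤; ≤-trans; ≤-reflexive; <-≤-trans; <-irrefl; <⇒≢;
         n<1+n; m<n⇒m<1+n; m≤m+n)
open import Data.Product using (∃; ∃-syntax; _×_; _,_; proj₁; proj₂)
open import Data.Sum as Sum using (_⊎_; inj₁; inj₂; [_,_]′)
open import Data.Unit using (⊤)
open import Data.Vec as Vec using (Vec; []; _∷_; lookup)
open import Data.Vec.Properties using (≡-dec)
open import Function using (_∘_; id; _↔_; _⇔_; mk⇔; mk↔ₛ′; Equivalence; Inverse)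
open import Function.Properties.Inverse using (↔-refl; ↔-sym; ↔-trans)
open import Level using (0ℓ)
open import Relation.Binary using (DecidableEquality; tri<; tri≈; tri>)
open import Relation.Binary.Construct.Closure.ReflexiveTransitive using (Star; ε; _◅_)
open import Relation.Binary.PropositionalEquality as ≡
  using (_≡_; _≢_; _≗_; refl; sym; cong; cong₂; subst; setoid)
  renaming (trans to ≡-trans)
open import Relation.Nullary using (Dec; yes; no; does; ¬?)
open import Relation.Nullary.Decidable using (_×-dec_)
open import Relation.Unary as Pred using (Pred; Decidable; _⊆_; _≐_; ｛_｝)
open import Defs

-- In a safe net, let t be a transition and Q some of its output places.  A term
-- u leads Q to a set of places B (Reads t Q u B) if it is the meet of the labels
-- of one token, a series composition through a transition consuming exactly
-- what its left factor delivers, or a parallel composition acting on disjoint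
-- sets of places.  Such a term can be fired from left to right with all other
-- tokens standing still, and safety keeps it away from the places of those
-- tokens; hence every term leading from the first to the last transition is
-- the trace of an accepting run.  Conversely, contracting a trace by the
-- rewriting system builds such a term.  The terms in question are regular:
-- parallel composition adds a place to the tokens standing still, so its
-- nesting depth is bounded by the number of places, and at a given depth
-- the series compositions are the walks of a finite automaton whose states are
-- the transitions, to which Kleene's construction applies.

-- A run interleaves independent branches arbitrarily, but its trace records only which transition
-- consumes which token. Hence it is enough to find some run with the right links; no interleaving
-- has to be reconstructed. A reading speaks only of the tokens that its own term moves. This is why
-- its factors can be exchanged one by one, as Kleene's construction does; idle tokens enter only
-- when the reading is fired, as an arbitrary context `C`. One transition can fire at several
-- vertices, so transitions alone do not tell the vertices of a term apart. Vertex names are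
-- therefore a parameter `V` with a map `τ` to transitions: names are transitions when terms are
-- read off expressions, numbered occurrences when a run is built, and positions when a run is
-- parsed. An expression also fixes one bracketing of series compositions, while contraction may
-- yield another. Membership is thus shown up to `_≈_`, which keeps the named vertices and the
-- arrows, and with them the graph.

private
  variable
    Y V A B : Set
    m n k   : ℕ

-- Isomorphism of graphs

≅-refl : {G : Graph Y} → G ≅ G
≅-refl = record
  { vertices = ↔-refl
  ; edge-⇔   = λ _ _ _ → mk⇔ id id
  ; input-≡  = refl
  ; output-≡ = refl
  }

≅-sym : {G H : Graph Y} → G ≅ H → H ≅ G
≅-sym {G = G} {H} φ = record
  { vertices = ↔-sym φ.vertices
  ; edge-⇔   = λ x a y → mk⇔
      (λ e → Equivalence.from (φ.edge-⇔ (φ.from x) a (φ.from y))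
               (≡.subst₂ (λ p q → edges H (p , a , q)) (sym (to∘from x)) (sym (to∘from y)) e))
      (λ e → ≡.subst₂ (λ p q → edges H (p , a , q)) (to∘from x) (to∘from y)
               (Equivalence.to (φ.edge-⇔ (φ.from x) a (φ.from y)) e))
  ; input-≡  = ≡-trans (cong φ.from (sym φ.input-≡)) (from∘to (input G))
  ; output-≡ = ≡-trans (cong φ.from (sym φ.output-≡)) (from∘to (output G))
  }
  where
  module φ = _≅_ φ
  to∘from = Inverse.strictlyInverseˡ φ.vertices
  from∘to = Inverse.strictlyInverseʳ φ.vertices

≅-trans : {G H K : Graph Y} → G ≅ H → H ≅ K → G ≅ K
≅-trans φ ψ = record
  { vertices = ↔-trans φ.vertices ψ.vertices
  ; edge-⇔   = λ x a y → mk⇔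
      (Equivalence.to (ψ.edge-⇔ _ a _) ∘ Equivalence.to (φ.edge-⇔ x a y))
      (Equivalence.from (φ.edge-⇔ x a y) ∘ Equivalence.from (ψ.edge-⇔ _ a _))
  ; input-≡  = ≡-trans (cong ψ.to φ.input-≡) ψ.input-≡
  ; output-≡ = ≡-trans (cong ψ.to φ.output-≡) ψ.output-≡
  }
  where
  module φ = _≅_ φ
  module ψ = _≅_ ψ

-- Terms whose inner vertices carry names

data NTerm (Y V : Set) : Set where
  letter : Y → NTerm Y V
  _·⟨_⟩_ : NTerm Y V → V → NTerm Y V → NTerm Y V
  _∩_    : NTerm Y V → NTerm Y V → NTerm Y V

infixr 7 _·⟨_⟩_

erase : NTerm Y V → Term Y
erase (letter a)    = letter a
erase (u ·⟨ w ⟩ v) = erase u · erase v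
erase (u ∩ v)       = erase u ∩ erase v

-- Listed in left-to-right firing order, so that the list can itself be fired as a run. The vertex
-- numbering of `termEdges` puts the merged vertex first instead, hence the permutations below.
nodes : NTerm Y V → List V
nodes (letter a)    = []
nodes (u ·⟨ w ⟩ v) = nodes u ++ w ∷ nodes v
nodes (u ∩ v)       = nodes u ++ nodes v

-- With the ends as arguments, composition renames no vertices: both compositions become plain
-- unions.
arrows : NTerm Y V → V → V → Pred (V × Y × V) 0ℓ
arrows (letter a)    x y = ｛ x , a , y ｝
arrows (u ·⟨ w ⟩ v) x y = arrows u x w Pred.∪ arrows v w y
arrows (u ∩ v)       x y = arrows u x y Pred.∪ arrows v x y

nodeAt : (u : NTerm Y V) → Fin (inner (erase u)) → V
nodeAt (u ·⟨ w ⟩ v) zero    = w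
nodeAt (u ·⟨ w ⟩ v) (suc j) = [ nodeAt u , nodeAt v ]′ (splitAt (inner (erase u)) j)
nodeAt (u ∩ v)       j       = [ nodeAt u , nodeAt v ]′ (splitAt (inner (erase u)) j)

put : V → V → (Fin n → V) → Fin (2 + n) → V
put x y f source        = x
put x y f sink          = y
put x y f (suc (suc j)) = f j

tabulate-+ : ∀ m {n} (f : Fin m → V) (g : Fin n → V) →
  tabulate ([ f , g ]′ ∘ splitAt m) ≡ tabulate f ++ tabulate g
tabulate-+ zero    f g = refl
tabulate-+ (suc m) f g = cong (f zero ∷_)
  (≡-trans (tabulate-cong (λ j → lemma (splitAt m j))) (tabulate-+ m (f ∘ suc) g))
  where
  lemma : ∀ s → [ f , g ]′ (Sum.map₁ suc s) ≡ [ f ∘ suc , g ]′ s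
  lemma (inj₁ _) = refl
  lemma (inj₂ _) = refl

tabulate-nodeAt : (u : NTerm Y V) → tabulate (nodeAt u) ↭ nodes u
tabulate-nodeAt (letter a)    = ↭-refl
tabulate-nodeAt (u ·⟨ w ⟩ v) = trans
  (prep w (trans (↭-reflexive (tabulate-+ _ (nodeAt u) (nodeAt v)))
                 (++⁺ (tabulate-nodeAt u) (tabulate-nodeAt v))))
  (↭-sym (shift w (nodes u) (nodes v)))
tabulate-nodeAt (u ∩ v)       = trans
  (↭-reflexive (tabulate-+ _ (nodeAt u) (nodeAt v)))
  (++⁺ (tabulate-nodeAt u) (tabulate-nodeAt v))

private
  splitˡ : (f : Fin m → V) (g : Fin n → V) → [ f , g ]′ ∘ splitAt m ∘ (_↑ˡ n) ≗ f
  splitˡ {m = m} {n = n} f g j = cong [ f , g ]′ (splitAt-↑ˡ m j n)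

  splitʳ : (f : Fin m → V) (g : Fin n → V) → [ f , g ]′ ∘ splitAt m ∘ (m ↑ʳ_) ≗ g
  splitʳ {m = m} {n = n} f g j = cong [ f , g ]′ (splitAt-↑ʳ m n j)

  ·ˡ : ∀ (u v : NTerm Y V) w x y →
    put x y (nodeAt (u ·⟨ w ⟩ v)) ∘
      place source (suc (suc zero)) (λ j → 3 ↑ʳ (j ↑ˡ inner (erase v)))
    ≗ put x w (nodeAt u)
  ·ˡ u v w x y source        = refl
  ·ˡ u v w x y sink          = refl
  ·ˡ u v w x y (suc (suc j)) = splitˡ (nodeAt u) (nodeAt v) j

  ·ʳ : ∀ (u v : NTerm Y V) w x y →
    put x y (nodeAt (u ·⟨ w ⟩ v)) ∘
      place (suc (suc zero)) sink (λ j → 3 ↑ʳ (inner (erase u) ↑ʳ j))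
    ≗ put w y (nodeAt v)
  ·ʳ u v w x y source        = refl
  ·ʳ u v w x y sink          = refl
  ·ʳ u v w x y (suc (suc j)) = splitʳ (nodeAt u) (nodeAt v) j

  ∩ˡ : ∀ (u v : NTerm Y V) x y →
    put x y (nodeAt (u ∩ v)) ∘ place source sink (λ j → 2 ↑ʳ (j ↑ˡ inner (erase v)))
    ≗ put x y (nodeAt u)
  ∩ˡ u v x y source        = refl
  ∩ˡ u v x y sink          = refl
  ∩ˡ u v x y (suc (suc j)) = splitˡ (nodeAt u) (nodeAt v) j

  ∩ʳ : ∀ (u v : NTerm Y V) x y →
    put x y (nodeAt (u ∩ v)) ∘ place source sink (λ j → 2 ↑ʳ (inner (erase u) ↑ʳ j))
    ≗ put x y (nodeAt v)
  ∩ʳ u v x y source        = refl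
  ∩ʳ u v x y sink          = refl
  ∩ʳ u v x y (suc (suc j)) = splitʳ (nodeAt u) (nodeAt v) j

Image : (Fin n → V) → Edges Y n → Pred (V × Y × V) 0ℓ
Image f E (x , a , y) = ∃[ p ] ∃[ q ] (E (p , a , q) × f p ≡ x × f q ≡ y)

private
  Image-∘⁺ : ∀ {k} {f : Fin k → V} {g : Fin n → Fin k} {h : Fin n → V}
    (E : Edges Y n) (E′ : Edges Y k) → f ∘ g ≗ h → (∀ e → image g id E e → E′ e) →
    Image h E ⊆ Image f E′
  Image-∘⁺ E E′ f∘g≗h E⊆E′ (p , q , e , refl , refl) =
    _ , _ , E⊆E′ _ (p , _ , q , e , refl , refl , refl) , f∘g≗h p , f∘g≗h q

  Image-∘⁻ : ∀ {k} {f : Fin k → V} {g : Fin n → Fin k} {h : Fin n → V} {E : Edges Y n} →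
    f ∘ g ≗ h → Image f (image g id E) ⊆ Image h E
  Image-∘⁻ f∘g≗h (_ , _ , (p , _ , q , e , refl , refl , refl) , refl , refl) =
    p , q , e , sym (f∘g≗h p) , sym (f∘g≗h q)

arrows⊆Image : ∀ (u : NTerm Y V) x y →
  arrows u x y ⊆ Image (put x y (nodeAt u)) (termEdges (erase u))
arrows⊆Image (letter a)    x y refl     = source , sink , refl , refl , refl
arrows⊆Image (u ·⟨ w ⟩ v) x y (inj₁ e) =
  Image-∘⁺ (termEdges (erase u)) (termEdges (erase u · erase v)) (·ˡ u v w x y)
    (λ _ → inj₁) (arrows⊆Image u x w e)
arrows⊆Image (u ·⟨ w ⟩ v) x y (inj₂ e) =
  Image-∘⁺ (termEdges (erase v)) (termEdges (erase u · erase v)) (·ʳ u v w x y)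
    (λ _ → inj₂) (arrows⊆Image v w y e)
arrows⊆Image (u ∩ v)       x y (inj₁ e) =
  Image-∘⁺ (termEdges (erase u)) (termEdges (erase u ∩ erase v)) (∩ˡ u v x y)
    (λ _ → inj₁) (arrows⊆Image u x y e)
arrows⊆Image (u ∩ v)       x y (inj₂ e) =
  Image-∘⁺ (termEdges (erase v)) (termEdges (erase u ∩ erase v)) (∩ʳ u v x y)
    (λ _ → inj₂) (arrows⊆Image v x y e)

Image⊆arrows : ∀ (u : NTerm Y V) x y →
  Image (put x y (nodeAt u)) (termEdges (erase u)) ⊆ arrows u x y
Image⊆arrows (letter a)    x y (_ , _ , refl , refl , refl) = refl
Image⊆arrows (u ·⟨ w ⟩ v) x y (p , q , inj₁ e , eqs) =
  inj₁ (Image⊆arrows u x w (Image-∘⁻ (·ˡ u v w x y) (p , q , e , eqs)))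
Image⊆arrows (u ·⟨ w ⟩ v) x y (p , q , inj₂ e , eqs) =
  inj₂ (Image⊆arrows v w y (Image-∘⁻ (·ʳ u v w x y) (p , q , e , eqs)))
Image⊆arrows (u ∩ v)       x y (p , q , inj₁ e , eqs) =
  inj₁ (Image⊆arrows u x y (Image-∘⁻ (∩ˡ u v x y) (p , q , e , eqs)))
Image⊆arrows (u ∩ v)       x y (p , q , inj₂ e , eqs) =
  inj₂ (Image⊆arrows v x y (Image-∘⁻ (∩ʳ u v x y) (p , q , e , eqs)))

-- Isomorphisms from matching vertex names

Injective : {A : Set} → (A → V) → Set
Injective f = ∀ {x y} → f x ≡ f y → x ≡ y

Unique-resp-↭ : {xs ys : List V} → xs ↭ ys → Unique xs → Unique ys
Unique-resp-↭ = Permutation.Unique-resp-↭ (setoid _) ∘ ↭⇒↭ₛ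

tabulate-injective : (f : Fin n → V) → Unique (tabulate f) → Injective f
tabulate-injective f (_ ∷ _)   {zero}  {zero}  _  = refl
tabulate-injective f (f≢ ∷ _)  {zero}  {suc y} eq = ⊥-elim (All.tabulate⁻ f≢ y eq)
tabulate-injective f (f≢ ∷ _)  {suc x} {zero}  eq = ⊥-elim (All.tabulate⁻ f≢ x (sym eq))
tabulate-injective f (_ ∷ u)   {suc x} {suc y} eq = cong suc (tabulate-injective (f ∘ suc) u eq)

module _ (f : Fin m → V) (g : Fin n → V) (g-injective : Injective g)
  (f↭g : tabulate f ↭ tabulate g) where

  private
    f-injective : Injective f
    f-injective = tabulate-injective f (Unique-resp-↭ (↭-sym f↭g) (Unique.tabulate⁺ g-injective))

    match : ∀ j → ∃[ k ] f j ≡ g k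
    match j = ∈-tabulate⁻ (∈-resp-↭ f↭g (∈-tabulate⁺ j))

    hctam : ∀ k → ∃[ j ] g k ≡ f j
    hctam k = ∈-tabulate⁻ (∈-resp-↭ (↭-sym f↭g) (∈-tabulate⁺ k))

  matching : Fin m ↔ Fin n
  matching = mk↔ₛ′ (proj₁ ∘ match) (proj₁ ∘ hctam)
    (λ k → g-injective (≡-trans (sym (proj₂ (match _))) (sym (proj₂ (hctam k)))))
    (λ j → f-injective (≡-trans (sym (proj₂ (hctam _))) (sym (proj₂ (match j)))))

  matching-≡ : ∀ j → g (Inverse.to matching j) ≡ f j
  matching-≡ j = sym (proj₂ (match j))

-- Vertices correspond when they carry the same name. The names given by `h` do not repeat, and this
-- passes to the term along the permutation, so the correspondence is a bijection and edges can be
-- compared among names.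
termGraph≅ : (u : NTerm Y V) (G : Graph Y) (h : Fin (size G) → V) → Injective h →
  ∀ {x y} → h (input G) ≡ x → h (output G) ≡ y → x ∷ y ∷ nodes u ↭ tabulate h →
  (∀ p a q → edges G (p , a , q) ⇔ arrows u x y (h p , a , h q)) →
  termGraph (erase u) ≅ G
termGraph≅ u G h h-injective refl refl nodes↭ edges⇔ = record
  { vertices = matching f h h-injective perm
  ; edge-⇔   = λ p a q → mk⇔
      (λ e → Equivalence.from (edges⇔ _ a _)
         (Image⊆arrows u x y (p , q , e , sym (matching-≡ f h h-injective perm p)
                                        , sym (matching-≡ f h h-injective perm q))))
      (λ e → back (arrows⊆Image u x y (Equivalence.to (edges⇔ _ a _) e)))
  ; input-≡  = h-injective (matching-≡ f h h-injective perm source)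
  ; output-≡ = h-injective (matching-≡ f h h-injective perm sink)
  }
  where
  x = h (input G)
  y = h (output G)
  f = put x y (nodeAt u)

  perm : tabulate f ↭ tabulate h
  perm = trans (prep x (prep y (tabulate-nodeAt u))) nodes↭

  back : ∀ {p a q} →
    Image f (termEdges (erase u))
      (h (Inverse.to (matching f h h-injective perm) p) , a ,
       h (Inverse.to (matching f h h-injective perm) q)) →
    termEdges (erase u) (p , a , q)
  back {p} {a} {q} (p′ , q′ , e , eqp , eqq) =
    ≡.subst₂ (λ p q → termEdges (erase u) (p , a , q))
      (f-injective (≡-trans eqp (matching-≡ f h h-injective perm p)))
      (f-injective (≡-trans eqq (matching-≡ f h h-injective perm q))) e
    where
    f-injective : Injective f
    f-injective = tabulate-injective f
      (Unique-resp-↭ (↭-sym perm) (Unique.tabulate⁺ h-injective))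

-- Sets of places

infix 4 _#_

_#_ : Subset n → Subset n → Set
S # R = ∀ {p} → p Subset.∈ S → p Subset.∉ R

#-sym : {S R : Subset n} → S # R → R # S
#-sym S#R p∈R p∈S = S#R p∈S p∈R

∩≡⊥⇒# : {S R : Subset n} → S Subset.∩ R ≡ Subset.⊥ → S # R
∩≡⊥⇒# eq p∈S p∈R = ∉⊥ (subst (_ Subset.∈_) eq (x∈p∩q⁺ (p∈S , p∈R)))

#⇒∩≡⊥ : {S R : Subset n} → S # R → S Subset.∩ R ≡ Subset.⊥
#⇒∩≡⊥ {S = S} {R} S#R = ⊆-antisym
  (λ p∈ → let (p∈S , p∈R) = x∈p∩q⁻ S R p∈ in ⊥-elim (S#R p∈S p∈R)) ⊥⊆

#-∪ʳ : (C : Subset n) {S R : Subset n} → C # S → C # R → C # S Subset.∪ R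
#-∪ʳ C {S} {R} C#S C#R p∈C p∈ = [ C#S p∈C , C#R p∈C ]′ (x∈p∪q⁻ S R p∈)

#-∪ˡ : {C D S : Subset n} → C # S → D # S → C Subset.∪ D # S
#-∪ˡ C#S D#S = #-sym (#-∪ʳ _ (#-sym C#S) (#-sym D#S))

∪-inˡ : {S R : Subset n} → S Subset.⊆ S Subset.∪ R
∪-inˡ = x∈p∪q⁺ ∘ inj₁

∪-inʳ : {S R : Subset n} → R Subset.⊆ S Subset.∪ R
∪-inʳ = x∈p∪q⁺ ∘ inj₂

∪-swap : ∀ (C S R : Subset n) → (C Subset.∪ S) Subset.∪ R ≡ (C Subset.∪ R) Subset.∪ S
∪-swap C S R = ≡-trans (∪-assoc C S R)
  (≡-trans (cong (C Subset.∪_) (∪-comm S R)) (sym (∪-assoc C R S)))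

x∈p─q⇒x∉q : ∀ {x} (p q : Subset n) → x Subset.∈ p Subset.─ q → x Subset.∉ q
x∈p─q⇒x∉q (_ ∷ p) (_ ∷ q) (Vec.there x∈) (Vec.there x∈q) = x∈p─q⇒x∉q p q x∈ x∈q

∣C∣<∣C∪S∣ : (C S : Subset n) → C # S → Nonempty S → Subset.∣ C ∣ ℕ.< Subset.∣ C Subset.∪ S ∣
∣C∣<∣C∪S∣ C S C#S (p , p∈S) = p⊂q⇒∣p∣<∣q∣ (∪-inˡ , p , ∪-inʳ {S = C} p∈S , λ p∈C → C#S p∈C p∈S)

∈-outputPlaces⁺ : (t : Transition Y n) → ∀ {a p} → (a , p) ∈ outputs t → p Subset.∈ outputPlaces t
∈-outputPlaces⁺ t = go (outputs t)
  where
  go : ∀ xs {a p} → (a , p) ∈ xs → p Subset.∈ Subset.⋃ (map (⁅_⁆ ∘ proj₂) xs)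
  go (_ ∷ xs) (here refl) = ∪-inˡ (x∈⁅x⁆ _)
  go (x ∷ xs) (there i)   = ∪-inʳ {S = ⁅ proj₂ x ⁆} (go xs i)

∈-outputPlaces⁻ : (t : Transition Y n) → ∀ {p} → p Subset.∈ outputPlaces t →
  ∃[ a ] (a , p) ∈ outputs t
∈-outputPlaces⁻ t = go (outputs t)
  where
  go : ∀ xs {p} → p Subset.∈ Subset.⋃ (map (⁅_⁆ ∘ proj₂) xs) → ∃[ a ] (a , p) ∈ xs
  go []             p∈ = ⊥-elim (∉⊥ p∈)
  go ((a , q) ∷ xs) p∈ with x∈p∪q⁻ ⁅ q ⁆ _ p∈
  ... | inj₁ p∈q with refl ← x∈⁅y⁆⇒x≡y q p∈q = a , here refl
  ... | inj₂ p∈xs = let (b , i) = go xs p∈xs in b , there i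

labels : Transition Y n → Fin n → List Y
labels t p = map proj₁ (filter (λ x → proj₂ x ≟ p) (outputs t))

∈-labels⁺ : (t : Transition Y n) → ∀ {a p} → (a , p) ∈ outputs t → a ∈ labels t p
∈-labels⁺ t {p = p} i = ∈-map⁺ proj₁ (∈-filter⁺ (λ x → proj₂ x ≟ p) i refl)

∈-labels⁻ : (t : Transition Y n) → ∀ {a p} → a ∈ labels t p → (a , p) ∈ outputs t
∈-labels⁻ t {p = p} i
  with (_ , q) , j , refl ← ∈-map⁻ proj₁ i
  with j′ , refl ← ∈-filter⁻ (λ x → proj₂ x ≟ p) {xs = outputs t} j = j′

-- A transition can put a token in one place under several letters; the trace then has a bundle of
-- parallel edges with a common producer and a common consumer. A repeated entry of `outputs`
-- repeats a factor but adds no edge, since edges form a set.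
meet : Y → List Y → NTerm Y V
meet a []       = letter a
meet a (b ∷ bs) = letter a ∩ meet b bs

nodes-meet : ∀ (a : Y) as → nodes {V = V} (meet a as) ≡ []
nodes-meet a []       = refl
nodes-meet a (b ∷ bs) = nodes-meet b bs

arrows-meet⁺ : ∀ {a b : Y} {as} {x y : V} → b ∈ a ∷ as → arrows (meet a as) x y (x , b , y)
arrows-meet⁺ {as = []}    (here refl) = refl
arrows-meet⁺ {as = _ ∷ _} (here refl) = inj₁ refl
arrows-meet⁺ {as = _ ∷ _} (there i)   = inj₂ (arrows-meet⁺ i)

arrows-meet⁻ : ∀ {a : Y} as {x y : V} {e} → arrows (meet a as) x y e →
  ∃[ b ] (b ∈ a ∷ as × (x , b , y) ≡ e)
arrows-meet⁻ []      refl        = _ , here refl , refl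
arrows-meet⁻ (_ ∷ _) (inj₁ refl) = _ , here refl , refl
arrows-meet⁻ (_ ∷ bs) (inj₂ e)   = let (b , i , eq) = arrows-meet⁻ bs e in b , there i , eq

-- Firing beside idle tokens

module _ {N : Net Y} where
  open Net N

  Run-++ : ∀ {S S′ S″} {ts : Vec _ m} {ts′ : Vec _ n} →
    Run N S ts S′ → Run N S′ ts′ S″ → Run N S (ts Vec.++ ts′) S″
  Run-++ []      r′ = r′
  Run-++ (x ∷ r) r′ = x ∷ Run-++ r r′

  Reachable-Run : ∀ {S S′} {ts : Vec _ n} → Reachable N S → Run N S ts S′ → Reachable N S′
  Reachable-Run (_ , _ , r) r′ = _ , _ , Run-++ r r′

  fire-∪ : ∀ {C} (t : Transition Y places) → C # inputs t →
    fire t (C Subset.∪ inputs t) ≡ C Subset.∪ outputPlaces t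
  fire-∪ {C} t C#t = ⊆-antisym
    (λ p∈ → case₁ (x∈p∪q⁻ (S Subset.─ inputs t) _ p∈))
    (λ p∈ → case₂ (x∈p∪q⁻ C _ p∈))
    where
    S = C Subset.∪ inputs t
    case₁ : ∀ {p} → p Subset.∈ S Subset.─ inputs t ⊎ p Subset.∈ outputPlaces t →
      p Subset.∈ C Subset.∪ outputPlaces t
    case₁ (inj₂ p∈) = ∪-inʳ {S = C} p∈
    case₁ (inj₁ p∈) with x∈p∪q⁻ C _ (p─q⊆p S (inputs t) p∈)
    ... | inj₁ p∈C = ∪-inˡ p∈C
    ... | inj₂ p∈t = ⊥-elim (x∈p─q⇒x∉q S (inputs t) p∈ p∈t)
    case₂ : ∀ {p} → p Subset.∈ C ⊎ p Subset.∈ outputPlaces t → p Subset.∈ fire t S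
    case₂ (inj₁ p∈) = ∪-inˡ (x∈p∧x∉q⇒x∈p─q (∪-inˡ p∈) (C#t p∈))
    case₂ (inj₂ p∈) = ∪-inʳ {S = S Subset.─ inputs t} p∈

  -- The empty context is kept in the result so that the state has the shape `C ∪ Q` in which
  -- readings are fired.
  fire-initial : ∀ (t : Transition Y places) → inputs t ≡ ⁅ initial ⁆ →
    fire t ⁅ initial ⁆ ≡ Subset.⊥ Subset.∪ outputPlaces t
  fire-initial t starts = ≡-trans
    (cong (fire t) (sym (≡-trans (∪-identityˡ (inputs t)) starts)))
    (fire-∪ t (λ p∈ → ⊥-elim (∉⊥ p∈)))

  module _ (safe : Safe N) where

    -- No token of `C` is consumed by `t`, so `C` lies in the part of the state that safety keeps
    -- clear of the outputs.
    safe-# : ∀ {C t} → Reachable N (C Subset.∪ inputs t) → t ∈ transitions → C # inputs t →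
      C # outputPlaces t
    safe-# {C} {t} reach t∈ C#t p∈C =
      ∩≡⊥⇒# (safe _ t reach t∈ (∪-inʳ {S = C})) (x∈p∧x∉q⇒x∈p─q (∪-inˡ p∈C) (C#t p∈C))

    fire-next : ∀ {C t} → Reachable N (C Subset.∪ inputs t) → t ∈ transitions → C # inputs t →
      Reachable N (C Subset.∪ outputPlaces t)
    fire-next {C} {t} reach t∈ C#t = Reachable-Run reach
      (subst (Run N _ _) (fire-∪ t C#t) ((t∈ , ∪-inʳ {S = C}) ∷ []))

-- Readings and their execution

module Reading (N : Net Y) {V : Set} (τ : V → Transition Y (Net.places N)) where
  open Net N

  -- The transition `t` is recorded because it fixes the labels of the tokens in `Q`. In `par`
  -- disjointness is demanded of the starting sets; for `B` and `D` it follows from safety when the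
  -- reading is fired in a reachable state.
  data Reads : Transition Y places → State N → NTerm Y V → State N → Set where
    atom : ∀ {t p a as} → labels t p ≡ a ∷ as → Reads t ⁅ p ⁆ (meet a as) ⁅ p ⁆
    ser  : ∀ {t Q u w v B} → Reads t Q u (inputs (τ w)) → τ w ∈ transitions →
           Reads (τ w) (outputPlaces (τ w)) v B → Reads t Q (u ·⟨ w ⟩ v) B
    par  : ∀ {t Q R u v B D} → Q # R → Reads t Q u B → Reads t R v D →
           Reads t (Q Subset.∪ R) (u ∩ v) (B Subset.∪ D)

  -- Each factor of a parallel composition thus adds at least one place to the context of the other,
  -- which is what bounds the nesting depth.
  Reads-nonempty : ∀ {t Q u B} → Reads t Q u B → Nonempty Q
  Reads-nonempty (atom _)     = _ , x∈⁅x⁆ _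
  Reads-nonempty (ser d _ _)  = Reads-nonempty d
  Reads-nonempty (par _ d d′) = let (p , p∈) = Reads-nonempty d in p , ∪-inˡ p∈

  Runs : State N → List V → State N → Set
  Runs S us S′ = Run N S (Vec.map τ (Vec.fromList us)) S′

  Runs-++ : ∀ {S us S′ vs S″} → Runs S us S′ → Runs S′ vs S″ → Runs S (us ++ vs) S″
  Runs-++ {us = []}    []      r′ = r′
  Runs-++ {us = _ ∷ _} (x ∷ r) r′ = x ∷ Runs-++ r r′

  -- tgt us σ p is the vertex consuming a token of p that is present before
  -- us fires, where σ gives the consumers of the tokens present after us.
  tgt : List V → (Fin places → V) → Fin places → V
  tgt []       σ p = σ p
  tgt (w ∷ us) σ p = if does (p ∈? inputs (τ w)) then w else tgt us σ p

  -- Restricting to `Q` lets the outgoing edges of one vertex be shared out among the factors of a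
  -- parallel composition.
  sends : Transition Y places → State N → V → (Fin places → V) → Pred (V × Y × V) 0ℓ
  sends t Q x σ (x′ , a , y) = ∃[ p ] ((a , p) ∈ outputs t × p Subset.∈ Q × x ≡ x′ × σ p ≡ y)

  emit : List V → (Fin places → V) → Pred (V × Y × V) 0ℓ
  emit []       σ = Pred.∅
  emit (w ∷ us) σ = sends (τ w) (outputPlaces (τ w)) w (tgt us σ) Pred.∪ emit us σ

  Untouched : State N → List V → Set
  Untouched C = All (λ w → C # inputs (τ w))

  Untouched-⊆ : ∀ {C D us} → D Subset.⊆ C → Untouched C us → Untouched D us
  Untouched-⊆ D⊆C []             = []
  Untouched-⊆ D⊆C (C#w ∷ C#us) = (λ p∈ → C#w (D⊆C p∈)) ∷ Untouched-⊆ D⊆C C#us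

  tgt-++ : ∀ us vs σ → tgt (us ++ vs) σ ≡ tgt us (tgt vs σ)
  tgt-++ []       vs σ = refl
  tgt-++ (w ∷ us) vs σ =
    cong (λ f p → if does (p ∈? inputs (τ w)) then w else f p) (tgt-++ us vs σ)

  emit-++⁺ : ∀ us vs σ → emit us (tgt vs σ) Pred.∪ emit vs σ ⊆ emit (us ++ vs) σ
  emit-++⁺ []       vs σ (inj₂ e)        = e
  emit-++⁺ (w ∷ us) vs σ (inj₁ (inj₁ e)) rewrite tgt-++ us vs σ = inj₁ e
  emit-++⁺ (w ∷ us) vs σ (inj₁ (inj₂ e)) = inj₂ (emit-++⁺ us vs σ (inj₁ e))
  emit-++⁺ (w ∷ us) vs σ (inj₂ e)        = inj₂ (emit-++⁺ us vs σ (inj₂ e))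

  emit-++⁻ : ∀ us vs σ → emit (us ++ vs) σ ⊆ emit us (tgt vs σ) Pred.∪ emit vs σ
  emit-++⁻ []       vs σ e        = inj₂ e
  emit-++⁻ (w ∷ us) vs σ (inj₁ e) rewrite tgt-++ us vs σ = inj₁ (inj₁ e)
  emit-++⁻ (w ∷ us) vs σ (inj₂ e) = Sum.map₁ inj₂ (emit-++⁻ us vs σ e)

  tgt-here : ∀ {w} us σ {p} → p Subset.∈ inputs (τ w) → tgt (w ∷ us) σ p ≡ w
  tgt-here {w} us σ {p} p∈ with p ∈? inputs (τ w)
  ... | yes _  = refl
  ... | no p∉ = ⊥-elim (p∉ p∈)

  tgt-there : ∀ {w} us σ {p} → p Subset.∉ inputs (τ w) → tgt (w ∷ us) σ p ≡ tgt us σ p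
  tgt-there {w} us σ {p} p∉ with p ∈? inputs (τ w)
  ... | yes p∈ = ⊥-elim (p∉ p∈)
  ... | no _   = refl

  tgt-untouched : ∀ {C us} σ → Untouched C us → ∀ {p} → p Subset.∈ C → tgt us σ p ≡ σ p
  tgt-untouched σ []                  p∈ = refl
  tgt-untouched {us = _ ∷ us} σ (C#w ∷ C#us) p∈ =
    ≡-trans (tgt-there us σ (C#w p∈)) (tgt-untouched σ C#us p∈)

  module _ (safe : Safe N) where

    -- The consumers of the tokens left by `u` depend on what fires later, so `arrows-≐` takes an
    -- arbitrary `σ` and constrains it only on `B`. The field `untouched` guarantees that edges of
    -- idle tokens pass over `u` unchanged.
    record Firing (C : State N) (t : Transition Y places) (Q : State N) (u : NTerm Y V)
      (B : State N) : Set where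
      field
        runs      : Runs (C Subset.∪ Q) (nodes u) (C Subset.∪ B)
        disjoint  : C # B
        untouched : Untouched C (nodes u)
        arrows-≐  : ∀ σ x y → (∀ {p} → p Subset.∈ B → σ p ≡ y) →
          sends t Q x (tgt (nodes u) σ) Pred.∪ emit (nodes u) σ ≐ arrows u x y

    -- Induction with `C` varying: a series composition keeps it, while in a parallel composition
    -- the tokens of the factor that is not firing join it.
    Reads⇒Firing : ∀ {C t Q u B} → Reads t Q u B → Reachable N (C Subset.∪ Q) → C # Q →
      Firing C t Q u B
    Reads⇒Firing {C} {t} (atom {p = p} {a} {as} eq) reach C#Q = record
      { runs      = subst (λ us → Runs _ us _) (sym (nodes-meet a as)) []
      ; disjoint  = C#Q
      ; untouched = subst (Untouched C) (sym (nodes-meet a as)) []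
      ; arrows-≐  = λ σ x y → λ σ≡y →
          subst (λ us → sends t ⁅ p ⁆ x (tgt us σ) Pred.∪ emit us σ ≐ arrows (meet a as) x y)
            (sym (nodes-meet a as)) (to σ≡y , from σ≡y)
      }
      where
      module _ {σ : Fin places → V} {x y : V} (σ≡y : ∀ {q} → q Subset.∈ ⁅ p ⁆ → σ q ≡ y) where
        to : sends t ⁅ p ⁆ x (tgt [] σ) Pred.∪ emit [] σ ⊆ arrows (meet a as) x y
        to (inj₁ (q , b∈ , q∈ , refl , refl))
          rewrite σ≡y q∈ with refl ← x∈⁅y⁆⇒x≡y p q∈ =
          arrows-meet⁺ (subst (_ ∈_) eq (∈-labels⁺ t b∈))

        from : arrows (meet a as) x y ⊆ sends t ⁅ p ⁆ x (tgt [] σ) Pred.∪ emit [] σ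
        from e with b , b∈ , refl ← arrows-meet⁻ as e =
          inj₁ (p , ∈-labels⁻ t (subst (b ∈_) (sym eq) b∈) , x∈⁅x⁆ p , refl , σ≡y (x∈⁅x⁆ p))
    Reads⇒Firing {C} {t} {Q} (ser {u = u} {w} {v} {B} d w∈ d′) reach C#Q = record
      { runs      = Runs-++ F.runs ((w∈ , ∪-inʳ {S = C}) ∷
                      subst (λ S → Runs S (nodes v) _)
                        (sym (fire-∪ {N = N} (τ w) F.disjoint)) F′.runs)
      ; disjoint  = F′.disjoint
      ; untouched = All.++⁺ F.untouched (F.disjoint ∷ F′.untouched)
      ; arrows-≐  = λ σ x y σ≡y → to σ≡y , from σ≡y
      }
      where
      module F = Firing (Reads⇒Firing {C} d reach C#Q)
      reach′ : Reachable N (C Subset.∪ inputs (τ w))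
      reach′ = Reachable-Run reach F.runs
      module F′ = Firing (Reads⇒Firing {C} d′ (fire-next safe {t = τ w} reach′ w∈ F.disjoint)
                           (safe-# safe {t = τ w} reach′ w∈ F.disjoint))
      us = nodes u
      vs = nodes v
      module _ {σ : Fin places → V} {x y : V} (σ≡y : ∀ {q} → q Subset.∈ B → σ q ≡ y) where
        -- The left factor delivers exactly the inputs of `w`, so under `σ′` all its tokens are
        -- consumed by `w`.
        σ′ = tgt (w ∷ vs) σ
        to : sends t Q x (tgt (us ++ w ∷ vs) σ) Pred.∪ emit (us ++ w ∷ vs) σ ⊆
             arrows (u ·⟨ w ⟩ v) x y
        to (inj₁ e) rewrite tgt-++ us (w ∷ vs) σ =
          inj₁ (proj₁ (F.arrows-≐ σ′ x w (tgt-here vs σ)) (inj₁ e))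
        to (inj₂ e) with emit-++⁻ us (w ∷ vs) σ e
        ... | inj₁ e′ = inj₁ (proj₁ (F.arrows-≐ σ′ x w (tgt-here vs σ)) (inj₂ e′))
        ... | inj₂ e′ = inj₂ (proj₁ (F′.arrows-≐ σ w y σ≡y) e′)

        from : arrows (u ·⟨ w ⟩ v) x y ⊆
               sends t Q x (tgt (us ++ w ∷ vs) σ) Pred.∪ emit (us ++ w ∷ vs) σ
        from (inj₂ e) = inj₂ (emit-++⁺ us (w ∷ vs) σ (inj₂ (proj₂ (F′.arrows-≐ σ w y σ≡y) e)))
        from (inj₁ e) with proj₂ (F.arrows-≐ σ′ x w (tgt-here vs σ)) e
        ... | inj₁ e′ rewrite tgt-++ us (w ∷ vs) σ = inj₁ e′
        ... | inj₂ e′ = inj₂ (emit-++⁺ us (w ∷ vs) σ (inj₁ e′))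
    Reads⇒Firing {C} {t} (par {Q = Q} {R} {u} {v} {B} {D} Q#R d d′) reach C#QR = record
      { runs      = Runs-++ (subst (λ S → Runs S us _) start F.runs)
                      (≡.subst₂ (λ S → Runs S vs) (∪-swap C B R) (∪-assoc C B D) F′.runs)
      ; disjoint  = #-∪ʳ C (λ p∈ → F.disjoint (∪-inˡ p∈)) (λ p∈ → F′.disjoint (∪-inˡ p∈))
      ; untouched = All.++⁺ (Untouched-⊆ ∪-inˡ F.untouched) (Untouched-⊆ ∪-inˡ F′.untouched)
      ; arrows-≐  = λ σ x y σ≡y → to σ≡y , from σ≡y
      }
      where
      start : (C Subset.∪ R) Subset.∪ Q ≡ C Subset.∪ (Q Subset.∪ R)
      start = ≡-trans (∪-swap C R Q) (∪-assoc C Q R)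
      C#Q : C # Q
      C#Q p∈ q∈ = C#QR p∈ (∪-inˡ q∈)
      C#R : C # R
      C#R p∈ q∈ = C#QR p∈ (∪-inʳ {S = Q} q∈)
      module F = Firing (Reads⇒Firing {C Subset.∪ R} d (subst (Reachable N) (sym start) reach)
                          (#-∪ˡ C#Q (#-sym Q#R)))
      B#R : B # R
      B#R p∈ q∈ = F.disjoint (∪-inʳ {S = C} q∈) p∈
      -- The left factor has fired by now, so what stands by is its result `B` and no longer `Q`.
      module F′ = Firing (Reads⇒Firing {C Subset.∪ B} d′
        (subst (Reachable N) (∪-swap C R B)
          (Reachable-Run (subst (Reachable N) (sym start) reach) F.runs))
        (#-∪ˡ C#R B#R))
      us = nodes u
      vs = nodes v
      module _ {σ : Fin places → V} {x y : V}
        (σ≡y : ∀ {q} → q Subset.∈ B Subset.∪ D → σ q ≡ y) where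
        σ′ = tgt vs σ

        F-≐ : sends t Q x (tgt us σ′) Pred.∪ emit us σ′ ≐ arrows u x y
        -- The tokens of `B` wait while the right factor fires, so `σ′` agrees with `σ` on them.
        F-≐ = F.arrows-≐ σ′ x y λ p∈ →
          ≡-trans (tgt-untouched σ F′.untouched (∪-inʳ {S = C} p∈)) (σ≡y (∪-inˡ p∈))

        F′-≐ : sends t R x σ′ Pred.∪ emit vs σ ≐ arrows v x y
        F′-≐ = F′.arrows-≐ σ x y λ p∈ → σ≡y (∪-inʳ {S = B} p∈)

        stays : ∀ {p} → p Subset.∈ R → tgt us σ′ p ≡ σ′ p
        stays p∈ = tgt-untouched σ′ F.untouched (∪-inʳ {S = C} p∈)

        to : sends t (Q Subset.∪ R) x (tgt (us ++ vs) σ) Pred.∪ emit (us ++ vs) σ ⊆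
             arrows (u ∩ v) x y
        to (inj₁ (p , i , p∈ , refl , eq)) rewrite tgt-++ us vs σ with x∈p∪q⁻ Q R p∈
        ... | inj₁ p∈Q = inj₁ (proj₁ F-≐ (inj₁ (p , i , p∈Q , refl , eq)))
        ... | inj₂ p∈R =
          inj₂ (proj₁ F′-≐ (inj₁ (p , i , p∈R , refl , ≡-trans (sym (stays p∈R)) eq)))
        to (inj₂ e) with emit-++⁻ us vs σ e
        ... | inj₁ e′ = inj₁ (proj₁ F-≐ (inj₂ e′))
        ... | inj₂ e′ = inj₂ (proj₁ F′-≐ (inj₂ e′))

        from : arrows (u ∩ v) x y ⊆
               sends t (Q Subset.∪ R) x (tgt (us ++ vs) σ) Pred.∪ emit (us ++ vs) σ
        from (inj₁ e) with proj₂ F-≐ e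
        ... | inj₂ e′ = inj₂ (emit-++⁺ us vs σ (inj₁ e′))
        ... | inj₁ (p , i , p∈ , eqs) rewrite tgt-++ us vs σ =
          inj₁ (p , i , ∪-inˡ p∈ , eqs)
        from (inj₂ e) with proj₂ F′-≐ e
        ... | inj₂ e′ = inj₂ (emit-++⁺ us vs σ (inj₂ e′))
        ... | inj₁ (p , i , p∈ , eq , eq′) rewrite tgt-++ us vs σ =
          inj₁ (p , i , ∪-inʳ {S = Q} p∈ , eq , ≡-trans (stays p∈) eq′)

-- Traces

First : Vec (Transition Y n) k → Fin n → Fin k → Set
First ts p l =
  p Subset.∈ inputs (lookup ts l) × (∀ l′ → l′ < l → p Subset.∉ inputs (lookup ts l′))

Link : Vec (Transition Y n) k → Fin n → Fin k → Fin k → Set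
Link ts p k l =
  k < l × p Subset.∈ inputs (lookup ts l) ×
  (∀ l′ → k < l′ → l′ < l → p Subset.∉ inputs (lookup ts l′))

module _ {t : Transition Y n} {ts : Vec (Transition Y n) k} {p : Fin n} where

  First-suc : ∀ {l} → p Subset.∉ inputs t → First ts p l → First (t ∷ ts) p (suc l)
  First-suc p∉ (p∈ , before) = p∈ , λ
    { zero     _        → p∉
    ; (suc l′) (s≤s lt) → before l′ lt
    }

  Link-zero⁺ : ∀ {l} → First ts p l → Link (t ∷ ts) p zero (suc l)
  Link-zero⁺ (p∈ , before) = s≤s z≤n , p∈ , λ { (suc l′) _ (s≤s lt) → before l′ lt }

  Link-zero⁻ : ∀ {l} → Link (t ∷ ts) p zero (suc l) → First ts p l
  Link-zero⁻ (_ , p∈ , between) = p∈ , λ l′ lt → between (suc l′) (s≤s z≤n) (s≤s lt)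

  Link-suc⁺ : ∀ {k l} → Link ts p k l → Link (t ∷ ts) p (suc k) (suc l)
  Link-suc⁺ (k<l , p∈ , between) =
    s≤s k<l , p∈ , λ { (suc l′) (s≤s lt) (s≤s lt′) → between l′ lt lt′ }

  Link-suc⁻ : ∀ {k l} → Link (t ∷ ts) p (suc k) (suc l) → Link ts p k l
  Link-suc⁻ (s≤s k<l , p∈ , between) =
    k<l , p∈ , λ l′ lt lt′ → between (suc l′) (s≤s lt) (s≤s lt′)

module _ {N : Net Y} where
  open Net N

  -- The final state is empty, so a token cannot survive the whole run.
  consumed : ∀ {S} {ts : Vec _ k} {p} → Run N S ts Subset.⊥ → p Subset.∈ S → ∃ (First ts p)
  consumed []                  p∈ = ⊥-elim (∉⊥ p∈)
  consumed {ts = t ∷ ts} {p} (_ ∷ r) p∈ with p ∈? inputs t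
  ... | yes p∈t = zero , p∈t , λ _ ()
  ... | no p∉t  =
    let (l , first) = consumed r (∪-inˡ (x∈p∧x∉q⇒x∈p─q p∈ p∉t))
    in suc l , First-suc {t = t} p∉t first

  consumer : ∀ {S} {ts : Vec _ k} {p} → Run N S ts Subset.⊥ → ∀ j →
    p Subset.∈ outputPlaces (lookup ts j) → ∃ (Link ts p j)
  consumer {S = S} {ts = t ∷ _} (_ ∷ r) zero p∈ =
    let (l , first) = consumed r (∪-inʳ {S = S Subset.─ inputs t} p∈)
    in suc l , Link-zero⁺ {t = t} first
  consumer {ts = t ∷ _} (_ ∷ r) (suc j) p∈ =
    let (l , link) = consumer r j p∈ in suc l , Link-suc⁺ {t = t} link

  -- The token is followed backwards from `l`; the record that nothing consumed it on the way
  -- becomes the last condition of `Link` once its producer is met.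
  producer : ∀ {S S′} {ts : Vec _ k} {p} → Run N S ts S′ → ∀ l → p Subset.∈ inputs (lookup ts l) →
    (p Subset.∈ S × (∀ l′ → l′ < l → p Subset.∉ inputs (lookup ts l′))) ⊎
    (∃[ j ] (p Subset.∈ outputPlaces (lookup ts j) × Link ts p j l))
  producer ((_ , enabled) ∷ r) zero    p∈ = inj₁ (enabled p∈ , λ _ ())
  producer {S = S} {ts = t ∷ _} (_ ∷ r) (suc l) p∈ with producer r l p∈
  ... | inj₂ (j , p∈j , link) = inj₂ (suc j , p∈j , Link-suc⁺ {t = t} link)
  ... | inj₁ (p∈S′ , before) with x∈p∪q⁻ (S Subset.─ inputs t) _ p∈S′
  ...   | inj₂ p∈t = inj₂ (zero , p∈t , Link-zero⁺ {t = t} (p∈ , before))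
  ...   | inj₁ p∈S = inj₁
    (p─q⊆p S (inputs t) p∈S ,
     proj₂ (First-suc {t = t} (x∈p─q⇒x∉q S (inputs t) p∈S) (p∈ , before)))

lookup-last : ∀ (x y : V) zs →
  List.lookup (x ∷ zs ++ List.[ y ]) (fromℕ (length (zs ++ List.[ y ]))) ≡ y
lookup-last x y []       = refl
lookup-last x y (z ∷ zs) = lookup-last z y zs

module Tracing (N : Net Y) {V : Set} (τ : V → Transition Y (Net.places N)) where
  open Net N
  open Reading N τ

  transitionsOf : (us : List V) → Vec (Transition Y places) (length us)
  transitionsOf us = Vec.map τ (Vec.fromList us)

  First⇒tgt : ∀ us σ {p l} → First (transitionsOf us) p l → tgt us σ p ≡ List.lookup us l
  First⇒tgt (w ∷ us) σ {l = zero}  (p∈ , _)      = tgt-here us σ p∈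
  First⇒tgt (w ∷ us) σ {l = suc l} (p∈ , before) = ≡-trans
    (tgt-there us σ (before zero (s≤s z≤n)))
    (First⇒tgt us σ (p∈ , λ l′ lt → before (suc l′) (s≤s lt)))

  traceEdges⇒emit : ∀ us σ {k a l} → traceEdges (transitionsOf us) (k , a , l) →
    emit us σ (List.lookup us k , a , List.lookup us l)
  traceEdges⇒emit (w ∷ us) σ {zero}  {l = suc l} (p , a∈ , link) =
    inj₁ (p , a∈ , ∈-outputPlaces⁺ (τ w) a∈ , refl , First⇒tgt us σ (Link-zero⁻ {t = τ w} link))
  traceEdges⇒emit (w ∷ us) σ {suc k} {l = suc l} (p , a∈ , link) =
    inj₂ (traceEdges⇒emit us σ (p , a∈ , Link-suc⁻ {t = τ w} link))

  -- As the run ends without tokens, each token finds its consumer inside `us` and the default `σ`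
  -- is never reached.
  emit⇒traceEdges : ∀ {S} us σ {x a y} → Runs S us Subset.⊥ → emit us σ (x , a , y) →
    ∃[ k ] ∃[ l ] (traceEdges (transitionsOf us) (k , a , l) ×
                   List.lookup us k ≡ x × List.lookup us l ≡ y)
  emit⇒traceEdges {S} (w ∷ us) σ (_ ∷ r) (inj₁ (p , a∈ , p∈ , refl , refl)) =
    let (l , first) = consumed r (∪-inʳ {S = S Subset.─ inputs (τ w)} p∈)
    in zero , suc l , (p , a∈ , Link-zero⁺ {t = τ w} first) , refl , sym (First⇒tgt us σ first)
  emit⇒traceEdges (w ∷ us) σ (_ ∷ r) (inj₂ e) =
    let (k , l , (p , a∈ , link) , eqs) = emit⇒traceEdges us σ r e
    in suc k , suc l , (p , a∈ , Link-suc⁺ {t = τ w} link) , eqs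

  module _ (safe : Safe N) {x y : V} {u : NTerm Y V}
    (x∈ : τ x ∈ transitions) (y∈ : τ y ∈ transitions)
    (starts : inputs (τ x) ≡ ⁅ initial ⁆) (stops : outputPlaces (τ y) ≡ Subset.⊥)
    (d : Reads (τ x) (outputPlaces (τ x)) u (inputs (τ y)))
    (unique : Unique (x ∷ nodes u ++ List.[ y ])) where

    private
      us vs : List V
      us = nodes u
      vs = x ∷ us ++ List.[ y ]
      C : State N
      C = Subset.⊥

      C# : {S : State N} → C # S
      C# p∈ = ⊥-elim (∉⊥ p∈)

      enabled : Enabled (τ x) ⁅ initial ⁆
      enabled = subst (_ Subset.∈_) starts

      fire₀ : fire (τ x) ⁅ initial ⁆ ≡ C Subset.∪ outputPlaces (τ x)
      fire₀ = fire-initial {N = N} (τ x) starts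

      fireₙ : fire (τ y) (C Subset.∪ inputs (τ y)) ≡ Subset.⊥
      fireₙ = ≡-trans (fire-∪ {N = N} (τ y) C#) (≡-trans (∪-identityˡ _) stops)

      module F = Firing (Reads⇒Firing safe {C} d
        (subst (Reachable N) fire₀ (_ , _ , (x∈ , enabled) ∷ [])) C#)

      accepting : Runs ⁅ initial ⁆ vs Subset.⊥
      accepting = (x∈ , enabled) ∷ subst (λ S → Runs S (us ++ List.[ y ]) _) (sym fire₀)
        (Runs-++ F.runs ((y∈ , ∪-inʳ {S = C}) ∷ subst (Run N _ []) fireₙ []))

      -- A default value: no token remains after `y` has fired.
      σ : Fin places → V
      σ _ = y

      arrows-≐ : sends (τ x) (outputPlaces (τ x)) x (tgt us (tgt List.[ y ] σ)) Pred.∪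
                 emit us (tgt List.[ y ] σ) ≐ arrows u x y
      arrows-≐ = F.arrows-≐ (tgt List.[ y ] σ) x y (tgt-here [] σ)

      emit⇒arrows : emit vs σ ⊆ arrows u x y
      emit⇒arrows (inj₁ e) rewrite tgt-++ us List.[ y ] σ = proj₁ arrows-≐ (inj₁ e)
      emit⇒arrows (inj₂ e) with emit-++⁻ us List.[ y ] σ e
      ... | inj₁ e′ = proj₁ arrows-≐ (inj₂ e′)
      ... | inj₂ (inj₁ (_ , _ , p∈ , _)) = ⊥-elim (∉⊥ (subst (_ Subset.∈_) stops p∈))

      arrows⇒emit : arrows u x y ⊆ emit vs σ
      arrows⇒emit e with proj₂ arrows-≐ e
      ... | inj₁ e′ =
        inj₁ (subst (λ f → sends (τ x) _ x f _) (sym (tgt-++ us List.[ y ] σ)) e′)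
      ... | inj₂ e′ = inj₂ (emit-++⁺ us List.[ y ] σ (inj₁ e′))

      lookup-injective : Injective (List.lookup vs)
      lookup-injective = tabulate-injective _ (subst Unique (sym (tabulate-lookup vs)) unique)

    -- The run fires `x`, then `u` from left to right in the empty context, then `y`. By `unique` a
    -- position is determined by its name, so arrows between names give back edges between
    -- positions.
    Reads⇒traces : traces N (termGraph (erase u))
    Reads⇒traces = _ , transitionsOf vs , accepting ,
      termGraph≅ u (trace (transitionsOf vs)) (List.lookup vs) lookup-injective refl
        (lookup-last x y us)
        (↭-trans (prep x (∷↭∷ʳ y us)) (↭-reflexive (sym (tabulate-lookup vs))))
        λ p a q → mk⇔ (λ e → emit⇒arrows (traceEdges⇒emit vs σ e))
          (λ e → back (emit⇒traceEdges vs σ accepting (arrows⇒emit e)))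
      where
      back : ∀ {p a q} →
        ∃[ k ] ∃[ l ] (traceEdges (transitionsOf vs) (k , a , l) ×
          List.lookup vs k ≡ List.lookup vs p × List.lookup vs l ≡ List.lookup vs q) →
        traceEdges (transitionsOf vs) (p , a , q)
      back {p} {a} {q} (k , l , e , eq , eq′) =
        ≡.subst₂ (λ p q → traceEdges (transitionsOf vs) (p , a , q))
          (lookup-injective {k} {p} eq) (lookup-injective {l} {q} eq′) e

-- Numbering the vertices of a term in the order of a run

number : ℕ → NTerm Y V → NTerm Y (ℕ × V)
number s (letter a)    = letter a
number s (u ·⟨ w ⟩ v) =
  number s u ·⟨ s + length (nodes u) , w ⟩ number (suc (s + length (nodes u))) v
number s (u ∩ v)       = number s u ∩ number (s + length (nodes u)) v

erase-number : ∀ s (u : NTerm Y V) → erase (number s u) ≡ erase u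
erase-number s (letter a)    = refl
erase-number s (u ·⟨ w ⟩ v) = cong₂ _·_ (erase-number s u) (erase-number _ v)
erase-number s (u ∩ v)       = cong₂ _∩_ (erase-number s u) (erase-number _ v)

enumerate : ℕ → List V → List (ℕ × V)
enumerate s []       = []
enumerate s (w ∷ ws) = (s , w) ∷ enumerate (suc s) ws

enumerate-++ : ∀ s (us vs : List V) →
  enumerate s (us ++ vs) ≡ enumerate s us ++ enumerate (s + length us) vs
enumerate-++ s []       vs = cong (λ i → enumerate i vs) (sym (+-identityʳ s))
enumerate-++ s (u ∷ us) vs = cong ((s , u) ∷_)
  (≡-trans (enumerate-++ (suc s) us vs)
    (cong (λ i → enumerate (suc s) us ++ enumerate i vs) (sym (+-suc s (length us)))))

nodes-number : ∀ s (u : NTerm Y V) → nodes (number s u) ≡ enumerate s (nodes u)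
nodes-number s (letter a)    = refl
nodes-number s (u ·⟨ w ⟩ v) = ≡-trans
  (cong₂ (λ us vs → us ++ (s + length (nodes u) , w) ∷ vs) (nodes-number s u) (nodes-number _ v))
  (sym (enumerate-++ s (nodes u) (w ∷ nodes v)))
nodes-number s (u ∩ v)       = ≡-trans
  (cong₂ _++_ (nodes-number s u) (nodes-number _ v))
  (sym (enumerate-++ s (nodes u) (nodes v)))

enumerate-> : ∀ {i} s (ws : List V) → i ℕ.< s → All (λ w → i ℕ.< proj₁ w) (enumerate s ws)
enumerate-> s []       i<s = []
enumerate-> s (_ ∷ ws) i<s = i<s ∷ enumerate-> (suc s) ws (m<n⇒m<1+n i<s)

enumerate-unique : ∀ s (ws : List V) → Unique (enumerate s ws)
enumerate-unique s []       = []
enumerate-unique s (w ∷ ws) =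
  All.map (λ s<i eq → <⇒≢ s<i (cong proj₁ eq)) (enumerate-> (suc s) ws (n<1+n s)) ∷
  enumerate-unique (suc s) ws

number-meet : ∀ s (a : Y) as → number {V = V} s (meet a as) ≡ meet a as
number-meet s a []       = refl
number-meet s a (b ∷ bs) = cong (letter a ∩_)
  (≡-trans (cong (λ i → number i _) (+-identityʳ s)) (number-meet s b bs))

module _ (N : Net Y) where
  open Net N

  private
    module Id = Reading N {Transition Y places} id
    module Numbered = Reading N {ℕ × Transition Y places} proj₂

  Reads-number : ∀ {t Q u B} s → Id.Reads t Q u B → Numbered.Reads t Q (number s u) B
  Reads-number s (Reading.atom {t} {p} {a} {as} eq) =
    subst (λ u → Numbered.Reads t ⁅ p ⁆ u ⁅ p ⁆) (sym (number-meet s a as)) (Reading.atom eq)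
  Reads-number s (Reading.ser d t∈ d′)   = Reading.ser (Reads-number s d) t∈ (Reads-number _ d′)
  Reads-number s (Reading.par Q#R d d′) = Reading.par Q#R (Reads-number s d) (Reads-number _ d′)

  -- A transition may occur at several vertices of `u`, so the names are first made distinct by
  -- numbering the occurrences in firing order. Number 0 goes to `s`, hence the inner vertices start
  -- at 1 and `t` takes the number after the last of them.
  Reads-id⇒traces : Safe N → ∀ {s t u} → s ∈ transitions → t ∈ transitions →
    inputs s ≡ ⁅ initial ⁆ → outputPlaces t ≡ Subset.⊥ →
    Id.Reads s (outputPlaces s) u (inputs t) → traces N (termGraph (erase u))
  Reads-id⇒traces safe {s} {t} {u} s∈ t∈ starts stops d =
    subst (λ v → traces N (termGraph v)) (erase-number 1 u)
      (Tracing.Reads⇒traces N proj₂ safe {0 , s} {_ , t} s∈ t∈ starts stops (Reads-number 1 d)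
        (subst Unique (cong ((0 , s) ∷_)
           (≡-trans (enumerate-++ 1 (nodes u) List.[ t ])
             (cong (_++ List.[ 1 + length (nodes u) , t ]) (sym (nodes-number 1 u)))))
           (enumerate-unique 0 (s ∷ nodes u ++ List.[ t ]))))

-- Expressions

⨆ : List A → (A → Expr Y) → Expr Y
⨆ []       f = 𝟎
⨆ (x ∷ xs) f = f x ∪ ⨆ xs f

⨆⁺ : ∀ {xs : List A} (f : A → Expr Y) {x u} → x ∈ xs → terms (f x) u → terms (⨆ xs f) u
⨆⁺ f (here refl) u∈ = inj₁ u∈
⨆⁺ f (there x∈)  u∈ = inj₂ (⨆⁺ f x∈ u∈)

⨆⁻ : ∀ (xs : List A) (f : A → Expr Y) {u} → terms (⨆ xs f) u → ∃[ x ] (x ∈ xs × terms (f x) u)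
⨆⁻ (x ∷ xs) f (inj₁ u∈) = x , here refl , u∈
⨆⁻ (x ∷ xs) f (inj₂ u∈) = let (y , y∈ , u∈′) = ⨆⁻ xs f u∈ in y , there y∈ , u∈′

guard : Dec A → Expr Y → Expr Y
guard (yes _) e = e
guard (no _)  e = 𝟎

guard⁺ : ∀ (d : Dec A) (e : Expr Y) {u} → A → terms e u → terms (guard d e) u
guard⁺ (yes _) e _ u∈ = u∈
guard⁺ (no ¬a) e a _  = ⊥-elim (¬a a)

guard⁻ : ∀ (d : Dec A) (e : Expr Y) {u} → terms (guard d e) u → A × terms e u
guard⁻ (yes a) e u∈ = a , u∈

meetᵉ : List Y → Expr Y
-- No labels means that the transition puts no token in the place.
meetᵉ []            = 𝟎
meetᵉ (a ∷ [])      = letter a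
meetᵉ (a ∷ b ∷ bs) = letter a ∩ meetᵉ (b ∷ bs)

meetᵉ⁺ : ∀ (a : Y) as → terms (meetᵉ (a ∷ as)) (erase {V = V} (meet a as))
meetᵉ⁺ a []       = refl
meetᵉ⁺ a (b ∷ bs) = _ , _ , refl , meetᵉ⁺ b bs , refl

meetᵉ⁻ : ∀ (as : List Y) {u} → terms (meetᵉ as) u →
  ∃[ b ] ∃[ bs ] (as ≡ b ∷ bs × erase {V = V} (meet b bs) ≡ u)
meetᵉ⁻ (a ∷ [])      refl = a , [] , refl , refl
meetᵉ⁻ {V = V} (a ∷ b ∷ bs) (_ , _ , refl , v∈ , refl) with meetᵉ⁻ {V = V} (b ∷ bs) v∈
... | _ , _ , refl , refl = a , b ∷ bs , refl , refl

_≟ˢ_ : DecidableEquality (Subset n)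
_≟ˢ_ = ≡-dec Bool._≟_

sides : List Subset.Side
sides = inside ∷ outside ∷ []

subsets : ∀ n → List (Subset n)
subsets zero    = [] ∷ []
subsets (suc n) = cartesianProductWith _∷_ sides (subsets n)

∈-subsets : ∀ (S : Subset n) → S ∈ subsets n
∈-subsets []            = here refl
∈-subsets (inside ∷ S)  = ∈-cartesianProductWith⁺ _∷_ {xs = sides} (here refl) (∈-subsets S)
∈-subsets (outside ∷ S) = ∈-cartesianProductWith⁺ _∷_ {xs = sides} (there (here refl)) (∈-subsets S)

-- Kleene's construction over transitions

module Expressions (N : Net Y) where
  open Net N

  -- The entry at `t`, `Q`, `B` is meant to describe terms leading the tokens that `t` put in `Q` to
  -- `B`.
  Family : Set
  Family = Transition Y places → State N → State N → Expr Y

  -- The list holds the transitions allowed at the cut points between factors. Passing through `s`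
  -- means delivering exactly its inputs and going on from all of its outputs. There is no unit
  -- expression, so passing once and passing repeatedly are separate summands.
  kleene : Family → List (Transition Y places) → Family
  kleene b []       t Q B = b t Q B
  kleene b (s ∷ ss) t Q B = kleene b ss t Q B ∪ enter · leave ∪ enter · loop ⁺ · leave
    where
    enter = kleene b ss t Q (inputs s)
    loop  = kleene b ss s (outputPlaces s) (inputs s)
    leave = kleene b ss s (outputPlaces s) B

  splits : Family → Family
  splits e t Q B =
    ⨆ (subsets places) λ Q₁ → ⨆ (subsets places) λ Q₂ →
    ⨆ (subsets places) λ B₁ → ⨆ (subsets places) λ B₂ →
    guard (((Q₁ Subset.∩ Q₂) ≟ˢ Subset.⊥) ×-dec
           ((Q₁ Subset.∪ Q₂) ≟ˢ Q) ×-dec ((B₁ Subset.∪ B₂) ≟ˢ B))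
          (e t Q₁ B₁ ∩ e t Q₂ B₂)

  singles : Family
  singles t Q B = ⨆ (allFin places) λ p →
    guard ((⁅ p ⁆ ≟ˢ Q) ×-dec (⁅ p ⁆ ≟ˢ B)) (meetᵉ (labels t p))

  -- The number bounds the nesting of parallel compositions.
  steps walks : ℕ → Family
  steps zero    t Q B = 𝟎
  steps (suc n) t Q B = singles t Q B ∪ splits (walks n) t Q B
  walks n = kleene (steps n) transitions

  module Soundness where
    open Reading N {Transition Y places} id

    Sound : Expr Y → Transition Y places → State N → State N → Set
    Sound e t Q B = ∀ {u} → terms e u → ∃[ v ] (erase v ≡ u × Reads t Q v B)

    ·-sound : ∀ e f {t s Q B} → s ∈ transitions →
      Sound e t Q (inputs s) → Sound f s (outputPlaces s) B → Sound (e · f) t Q B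
    ·-sound e f s∈ e-sound f-sound (_ , _ , u∈ , v∈ , refl)
      with _ , refl , d ← e-sound u∈ | _ , refl , d′ ← f-sound v∈ = _ , refl , ser d s∈ d′

    ⁺-sound : ∀ e {s} → s ∈ transitions → Sound e s (outputPlaces s) (inputs s) →
      Sound (e ⁺) s (outputPlaces s) (inputs s)
    ⁺-sound e s∈ e-sound [ u∈ ]    = e-sound u∈
    ⁺-sound e s∈ e-sound (u∈ ∷ us∈)
      with _ , refl , d ← e-sound u∈ | _ , refl , d′ ← ⁺-sound e s∈ e-sound us∈ =
      _ , refl , ser d s∈ d′

    kleene-sound : ∀ b → (∀ t Q B → Sound (b t Q B) t Q B) →
      ∀ ss → (∀ {s} → s ∈ ss → s ∈ transitions) → ∀ t Q B → Sound (kleene b ss t Q B) t Q B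
    kleene-sound b b-sound []       ss⊆ t Q B = b-sound t Q B
    kleene-sound b b-sound (s ∷ ss) ss⊆ t Q B = λ
      { (inj₁ u∈)        → rec t Q B u∈
      ; (inj₂ (inj₁ u∈)) → ·-sound enter leave s∈ (rec t Q _) (rec s _ B) u∈
      ; (inj₂ (inj₂ u∈)) → ·-sound enter (loop ⁺ · leave) s∈ (rec t Q _)
          (·-sound (loop ⁺) leave s∈ (⁺-sound loop s∈ (rec s _ _)) (rec s _ B)) u∈
      }
      where
      s∈    = ss⊆ (here refl)
      rec   = kleene-sound b b-sound ss (ss⊆ ∘ there)
      enter = kleene b ss t Q (inputs s)
      loop  = kleene b ss s (outputPlaces s) (inputs s)
      leave = kleene b ss s (outputPlaces s) B

    singles-sound : ∀ t Q B → Sound (singles t Q B) t Q B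
    singles-sound t Q B u∈
      with p , _ , u∈′ ← ⨆⁻ (allFin places) _ u∈
      with (refl , refl) , u∈″ ← guard⁻ ((⁅ p ⁆ ≟ˢ Q) ×-dec (⁅ p ⁆ ≟ˢ B)) _ u∈′
      with _ , _ , eq , refl ←
        meetᵉ⁻ {V = Transition Y places} (labels t p) u∈″ = _ , refl , atom eq

    splits-sound : ∀ e → (∀ t Q B → Sound (e t Q B) t Q B) →
      ∀ t Q B → Sound (splits e t Q B) t Q B
    splits-sound e e-sound t Q B u∈
      with Q₁ , _ , u∈ ← ⨆⁻ (subsets places) _ u∈
      with Q₂ , _ , u∈ ← ⨆⁻ (subsets places) _ u∈
      with B₁ , _ , u∈ ← ⨆⁻ (subsets places) _ u∈
      with B₂ , _ , u∈ ← ⨆⁻ (subsets places) _ u∈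
      with (Q₁∩Q₂≡⊥ , refl , refl) , (_ , _ , v∈ , w∈ , refl) ←
        guard⁻ (((Q₁ Subset.∩ Q₂) ≟ˢ Subset.⊥) ×-dec
           ((Q₁ Subset.∪ Q₂) ≟ˢ Q) ×-dec ((B₁ Subset.∪ B₂) ≟ˢ B)) _ u∈
      with _ , refl , d ← e-sound t Q₁ B₁ v∈ | _ , refl , d′ ← e-sound t Q₂ B₂ w∈ =
      _ , refl , par (∩≡⊥⇒# Q₁∩Q₂≡⊥) d d′

    steps-sound : ∀ n t Q B → Sound (steps n t Q B) t Q B
    walks-sound : ∀ n t Q B → Sound (walks n t Q B) t Q B
    steps-sound (suc n) t Q B (inj₁ u∈) = singles-sound t Q B u∈
    steps-sound (suc n) t Q B (inj₂ u∈) = splits-sound (walks n) (walks-sound n) t Q B u∈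
    walks-sound n = kleene-sound (steps n) (steps-sound n) transitions id

-- Equality up to the bracketing of series compositions

infix 4 _≈_

record _≈_ (u v : NTerm Y V) : Set where
  field
    ≈⇒↭  : nodes u ↭ nodes v
    ≈⇒≐ : ∀ x y → arrows u x y ≐ arrows v x y

open _≈_ public

≈-refl : {u : NTerm Y V} → u ≈ u
≈-refl = record { ≈⇒↭ = ↭-refl ; ≈⇒≐ = λ _ _ → id , id }

≈-trans : {u v w : NTerm Y V} → u ≈ v → v ≈ w → u ≈ w
≈-trans p q = record
  { ≈⇒↭  = ↭-trans (≈⇒↭ p) (≈⇒↭ q)
  ; ≈⇒≐  = λ x y → proj₁ (≈⇒≐ q x y) ∘ proj₁ (≈⇒≐ p x y) ,
                        proj₂ (≈⇒≐ p x y) ∘ proj₂ (≈⇒≐ q x y)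
  }

·-cong : ∀ {u u′ v v′ : NTerm Y V} {w} → u ≈ u′ → v ≈ v′ → u ·⟨ w ⟩ v ≈ u′ ·⟨ w ⟩ v′
·-cong {w = w} p q = record
  { ≈⇒↭  = ++⁺ (≈⇒↭ p) (prep w (≈⇒↭ q))
  ; ≈⇒≐  = λ x y → Sum.map (proj₁ (≈⇒≐ p x w)) (proj₁ (≈⇒≐ q w y)) ,
                        Sum.map (proj₂ (≈⇒≐ p x w)) (proj₂ (≈⇒≐ q w y))
  }

∩-cong : ∀ {u u′ v v′ : NTerm Y V} → u ≈ u′ → v ≈ v′ → (u ∩ v) ≈ (u′ ∩ v′)
∩-cong p q = record
  { ≈⇒↭  = ++⁺ (≈⇒↭ p) (≈⇒↭ q)
  ; ≈⇒≐  = λ x y → Sum.map (proj₁ (≈⇒≐ p x y)) (proj₁ (≈⇒≐ q x y)) ,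
                        Sum.map (proj₂ (≈⇒≐ p x y)) (proj₂ (≈⇒≐ q x y))
  }

·-assoc : ∀ (u v w : NTerm Y V) x y → (u ·⟨ x ⟩ v) ·⟨ y ⟩ w ≈ u ·⟨ x ⟩ (v ·⟨ y ⟩ w)
·-assoc u v w x y = record
  { ≈⇒↭  = ↭-reflexive (++-assoc (nodes u) (x ∷ nodes v) (y ∷ nodes w))
  ; ≈⇒≐  = λ _ _ → Sum.assocʳ , Sum.assocˡ
  }

·-assoc⁻ : ∀ (u v w : NTerm Y V) x y → u ·⟨ x ⟩ (v ·⟨ y ⟩ w) ≈ (u ·⟨ x ⟩ v) ·⟨ y ⟩ w
·-assoc⁻ u v w x y = record
  { ≈⇒↭  = ↭-reflexive (sym (++-assoc (nodes u) (x ∷ nodes v) (y ∷ nodes w)))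
  ; ≈⇒≐  = λ _ _ → Sum.assocˡ , Sum.assocʳ
  }

infix 4 _∈≈_

-- The witness `v` may be bracketed otherwise than `u`; the relation retains all that `termGraph≅`
-- looks at.
_∈≈_ : NTerm Y V → Expr Y → Set
u ∈≈ e = ∃[ v ] (u ≈ v × terms e (erase v))

-- Every reading is covered by the expressions

module Completeness (N : Net Y) {V : Set} (τ : V → Transition Y (Net.places N)) where
  open Net N
  open Expressions N
  open Reading N τ

  module _ (b : Family) where

    data Walk (ss : List (Transition Y places)) (t : Transition Y places) (Q : State N) :
      NTerm Y V → State N → Set where
      [_]  : ∀ {u B} → terms (b t Q B) (erase u) → Walk ss t Q u B
      cons : ∀ {u w v B} → terms (b t Q (inputs (τ w))) (erase u) → τ w ∈ ss →
             Walk ss (τ w) (outputPlaces (τ w)) v B → Walk ss t Q (u ·⟨ w ⟩ v) B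

    data Loops (ss : List (Transition Y places)) (s : Transition Y places) (B : State N) :
      NTerm Y V → Set where
      [_] : ∀ {u} → Walk ss s (outputPlaces s) u B → Loops ss s B u
      _∷_ : ∀ {u w v} → Walk ss s (outputPlaces s) u (inputs s) → Loops ss s B v →
            Loops ss s B (u ·⟨ w ⟩ v)

    -- The walk is cut at each vertex whose membership proof points to the head `s`; the pieces in
    -- between use `ss` only. Bringing the first cut to the root needs rebracketing.
    split : ∀ {s ss t Q u B} → Walk (s ∷ ss) t Q u B →
      Walk ss t Q u B ⊎
      ∃[ x ] ∃[ w ] ∃[ y ] (u ≈ x ·⟨ w ⟩ y × Walk ss t Q x (inputs s) × Loops ss s B y)
    split [ h ] = inj₁ [ h ]
    split (cons h (here refl) r) with split r
    ... | inj₁ r′ = inj₂ (_ , _ , _ , ≈-refl , [ h ] , [ r′ ])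
    ... | inj₂ (x , w , y , eq , r′ , l) =
      inj₂ (_ , _ , x ·⟨ w ⟩ y , ·-cong ≈-refl eq , [ h ] , r′ ∷ l)
    split (cons {u} {w} h (there i) r) with split r
    ... | inj₁ r′ = inj₁ (cons h i r′)
    ... | inj₂ (x , z , y , eq , r′ , l) =
      inj₂ (u ·⟨ w ⟩ x , z , y , ≈-trans (·-cong ≈-refl eq) (·-assoc⁻ u x y w z) , cons h i r′ , l)

    join : ∀ {ss t Q u w v B} → Walk ss t Q u (inputs (τ w)) → τ w ∈ ss →
      Walk ss (τ w) (outputPlaces (τ w)) v B → ∃[ z ] (u ·⟨ w ⟩ v ≈ z × Walk ss t Q z B)
    join [ h ] i r = _ , ≈-refl , cons h i r
    join {w = w} {v} (cons {u} {x} {y} h j r′) i r =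
      let (z , eq , r″) = join r′ i r
      in u ·⟨ x ⟩ z , ≈-trans (·-assoc u y v x w) (·-cong ≈-refl eq) , cons h j r″

    Walk⇒kleene : ∀ ss {t Q u B} → Walk ss t Q u B → u ∈≈ kleene b ss t Q B
    -- The last piece leaves `s` for good and the earlier ones form `loop ⁺`. The latter is never
    -- empty, whence the separate case of a single piece.
    Loops⇒kleene : ∀ {ss s B u} → Loops ss s B u →
      let loop  = kleene b ss s (outputPlaces s) (inputs s)
          leave = kleene b ss s (outputPlaces s) B
      in u ∈≈ leave ⊎
         ∃[ x ] ∃[ w ] ∃[ y ] (u ≈ x ·⟨ w ⟩ y × terms (loop ⁺) (erase x) × terms leave (erase y))
    Loops⇒kleene {ss} [ r ]                 = inj₁ (Walk⇒kleene ss r)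
    Loops⇒kleene {ss} (_∷_ {w = w} r l) with Walk⇒kleene ss r | Loops⇒kleene l
    ... | u , eq , u∈ | inj₁ (v , eq′ , v∈) = inj₂ (u , w , v , ·-cong eq eq′ , [ u∈ ] , v∈)
    ... | u , eq , u∈ | inj₂ (x , z , y , eq′ , x∈ , y∈) =
      inj₂ (u ·⟨ w ⟩ x , z , y ,
            ≈-trans (·-cong eq eq′) (·-assoc⁻ u x y w z) , u∈ ∷ x∈ , y∈)
    Walk⇒kleene []       [ h ] = _ , ≈-refl , h
    Walk⇒kleene (s ∷ ss) r with split r
    ... | inj₁ r′ = let (v , eq , v∈) = Walk⇒kleene ss r′ in v , eq , inj₁ v∈
    ... | inj₂ (x , w , y , eq , r′ , l) with Walk⇒kleene ss r′ | Loops⇒kleene l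
    ...   | x′ , eq′ , x∈ | inj₁ (y′ , eq″ , y∈) =
      x′ ·⟨ w ⟩ y′ , ≈-trans eq (·-cong eq′ eq″) , inj₂ (inj₁ (_ , _ , x∈ , y∈ , refl))
    ...   | x′ , eq′ , x∈ | inj₂ (u , z , v , eq″ , u∈ , v∈) =
      x′ ·⟨ w ⟩ (u ·⟨ z ⟩ v) , ≈-trans eq (·-cong eq′ eq″) ,
      inj₂ (inj₂ (_ , _ , x∈ , (_ , _ , u∈ , v∈ , refl) , refl))

  singles⁺ : ∀ {t p u} → terms (meetᵉ (labels t p)) u → terms (singles t ⁅ p ⁆ ⁅ p ⁆) u
  singles⁺ {p = p} u∈ = ⨆⁺ _ (∈-allFin p)
    (guard⁺ ((⁅ p ⁆ ≟ˢ ⁅ p ⁆) ×-dec (⁅ p ⁆ ≟ˢ ⁅ p ⁆)) _ (refl , refl) u∈)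

  splits⁺ : ∀ e {t Q R B D u v} → Q # R → terms (e t Q B) u → terms (e t R D) v →
    terms (splits e t (Q Subset.∪ R) (B Subset.∪ D)) (u ∩ v)
  splits⁺ e {t} {Q} {R} {B} {D} Q#R u∈ v∈ =
    ⨆⁺ _ (∈-subsets Q) (⨆⁺ _ (∈-subsets R) (⨆⁺ _ (∈-subsets B) (⨆⁺ _ (∈-subsets D)
      (guard⁺ (((Q Subset.∩ R) ≟ˢ Subset.⊥) ×-dec
               ((Q Subset.∪ R) ≟ˢ (Q Subset.∪ R)) ×-dec ((B Subset.∪ D) ≟ˢ (B Subset.∪ D)))
              (e t Q B ∩ e t R D)
        (#⇒∩≡⊥ Q#R , refl , refl) (_ , _ , u∈ , v∈ , refl)))))

  module _ (safe : Safe N) where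

    -- Parallel composition moves the tokens of one side into the context C of
    -- the other, so that its nesting depth is at most places ∸ ∣ C ∣.
    Reads⇒Walk : ∀ n {C t Q u B} → Reads t Q u B → Reachable N (C Subset.∪ Q) → C # Q →
      places ≤ n + Subset.∣ C ∣ → ∃[ v ] (u ≈ v × Walk (steps n) transitions t Q v B)
    -- At bound 0 the context would already fill all places, yet the nonempty `Q` lies outside it.
    Reads⇒Walk zero {C} {Q = Q} d reach C#Q bound = ⊥-elim (<-irrefl refl
      (<-≤-trans (∣C∣<∣C∪S∣ C Q C#Q (Reads-nonempty d)) (≤-trans (∣p∣≤n (C Subset.∪ Q)) bound)))
    Reads⇒Walk (suc n) (atom {t} {p} {a} {as} eq) reach C#Q bound =
      _ , ≈-refl ,
      [ inj₁ (singles⁺ {t} (subst (λ xs → terms (meetᵉ xs) (erase (meet {V = V} a as)))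
                             (sym eq) (meetᵉ⁺ a as))) ]
    Reads⇒Walk (suc n) {C} (ser {w = w} d w∈ d′) reach C#Q bound =
      let module F = Firing (Reads⇒Firing safe {C} d reach C#Q)
          reach′ = Reachable-Run reach F.runs
          (u , eq , r)   = Reads⇒Walk (suc n) {C} d reach C#Q bound
          (v , eq′ , r′) = Reads⇒Walk (suc n) {C} d′ (fire-next safe {t = τ w} reach′ w∈ F.disjoint)
                             (safe-# safe {t = τ w} reach′ w∈ F.disjoint) bound
          (z , eq″ , r″) = join (steps (suc n)) r w∈ r′
      in z , ≈-trans (·-cong eq eq′) eq″ , r″
    Reads⇒Walk (suc n) {C} (par {Q = Q} {R} Q#R d d′) reach C#QR bound =
      let (u , eq , r)    = Reads⇒Walk n {C Subset.∪ R} d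
                              (subst (Reachable N) C∪Q∪R reach)
                              (#-∪ˡ (λ p∈ q∈ → C#QR p∈ (∪-inˡ q∈)) (#-sym Q#R))
                              (grow R (λ p∈ q∈ → C#QR p∈ (∪-inʳ {S = Q} q∈)) (Reads-nonempty d′))
          -- Nothing is fired here: the right factor is examined in the state where `Q` still
          -- stands, so both contexts are obtained from the same reachable state.
          (v , eq′ , r′)  = Reads⇒Walk n {C Subset.∪ Q} d′
                              (subst (Reachable N) (sym (∪-assoc C Q R)) reach)
                              (#-∪ˡ (λ p∈ q∈ → C#QR p∈ (∪-inʳ {S = Q} q∈)) Q#R)
                              (grow Q (λ p∈ q∈ → C#QR p∈ (∪-inˡ q∈)) (Reads-nonempty d))
          (u′ , eq″ , u∈) = Walk⇒kleene (steps n) transitions r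
          (v′ , eq‴ , v∈) = Walk⇒kleene (steps n) transitions r′
      in u′ ∩ v′ , ∩-cong (≈-trans eq eq″) (≈-trans eq′ eq‴) ,
         [ inj₂ (splits⁺ (walks n) Q#R u∈ v∈) ]
      where
      C∪Q∪R : C Subset.∪ (Q Subset.∪ R) ≡ (C Subset.∪ R) Subset.∪ Q
      C∪Q∪R = ≡-trans (sym (∪-assoc C Q R)) (∪-swap C Q R)
      grow : ∀ S → C # S → Nonempty S → places ≤ n + Subset.∣ C Subset.∪ S ∣
      grow S C#S nonempty = ≤-trans bound (≤-trans (≤-reflexive (sym (+-suc n _)))
        (+-monoʳ-≤ n (∣C∣<∣C∪S∣ C S C#S nonempty)))

    Reads⇒walks : ∀ {t u B} → Reads t (outputPlaces t) u B →
      Reachable N (Subset.⊥ Subset.∪ outputPlaces t) → u ∈≈ walks places t (outputPlaces t) B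
    Reads⇒walks d reach =
      let (v , eq , r)   = Reads⇒Walk places {Subset.⊥} d reach
                             (λ p∈ → ⊥-elim (∉⊥ p∈)) (m≤m+n places _)
          (w , eq′ , w∈) = Walk⇒kleene (steps places) transitions r
      in w , ≈-trans eq eq′ , w∈

-- Lists up to permutation

filter-↭ : {P : Pred A 0ℓ} (P? : Decidable P) (xs : List A) →
  xs ↭ filter P? xs ++ filter (¬? ∘ P?) xs
filter-↭ P? []       = ↭-refl
filter-↭ P? (x ∷ xs) with P? x
... | yes _ = prep x (filter-↭ P? xs)
... | no _  = ↭-trans (prep x (filter-↭ P? xs)) (↭-sym (shift x (filter P? xs) _))

AllPairs-++⁻ : {R : A → A → Set} (xs : List A) {ys : List A} → AllPairs R (xs ++ ys) →
  AllPairs R xs × All (λ x → All (R x) ys) xs × AllPairs R ys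
AllPairs-++⁻ []       ps       = [] , [] , ps
AllPairs-++⁻ (x ∷ xs) (p ∷ ps) =
  let (ps₁ , ps₂ , ps₃) = AllPairs-++⁻ xs ps
      (p₁ , p₂) = All.++⁻ xs p
  in p₁ ∷ ps₁ , p₂ ∷ ps₂ , ps₃

tabulate-punchIn : (f : Fin (suc n) → A) (i : Fin (suc n)) →
  tabulate f ↭ f i ∷ tabulate (f ∘ punchIn i)
tabulate-punchIn f zero    = ↭-refl
tabulate-punchIn {n = suc n} f (suc i) =
  ↭-trans (prep (f zero) (tabulate-punchIn (f ∘ suc) i)) (swap _ _ ↭-refl)

concatMap-++ : (f : A → List B) (xs ys : List A) →
  concatMap f (xs ++ ys) ≡ concatMap f xs ++ concatMap f ys
concatMap-++ f []       ys = refl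
concatMap-++ f (x ∷ xs) ys =
  ≡-trans (cong (f x ++_) (concatMap-++ f xs ys)) (sym (++-assoc (f x) _ _))

concatMap-↭ : (f : A → List B) {xs ys : List A} → xs ↭ ys → concatMap f xs ↭ concatMap f ys
concatMap-↭ f refl         = ↭-refl
concatMap-↭ f (prep x p)   = ++⁺ˡ (f x) (concatMap-↭ f p)
concatMap-↭ f (swap x y p) =
  ↭-trans (++⁺ˡ (f x) (++⁺ˡ (f y) (concatMap-↭ f p))) (shifts (f x) (f y))
concatMap-↭ f (trans p q)  = ↭-trans (concatMap-↭ f p) (concatMap-↭ f q)

-- Parsing a trace along its contraction

module Rewriting (N : Net Y) {k : ℕ} (τ : Fin k → Transition Y (Net.places N))
  (τ∈ : ∀ w → τ w ∈ Net.transitions N) where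
  open Net N
  open Reading N τ

  Vertex : Set
  Vertex = Fin k

  -- Inclusions, because a cell may carry only some of the tokens leaving `src` or entering `dst`.
  -- Equality comes about when all cells at that end are merged.
  record Cell : Set where
    field
      src dst : Vertex
      {From To} : State N
      {term}  : NTerm Y Vertex
      reads   : Reads (τ src) From term To
      From⊆   : From Subset.⊆ outputPlaces (τ src)
      To⊆     : To Subset.⊆ inputs (τ dst)

  open Cell public

  cellEdges : Cell → Pred (Vertex × Y × Vertex) 0ℓ
  cellEdges c = arrows (term c) (src c) (dst c)

  cellNodes : Cell → List Vertex
  cellNodes = nodes ∘ term

  -- Conditional on a common source: cells that leave different vertices may use the same place at
  -- different times of the run.
  Apart : Cell → Cell → Set
  Apart c d = src c ≡ src d → From c # From d

  Apart-sym : ∀ c d → Apart c d → Apart d c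
  Apart-sym c d c#d eq p∈d p∈c = c#d (sym eq) p∈c p∈d

  -- Parallel rules are not mirrored one by one: the cells between two vertices stay separate until
  -- a series rule or the end of the rewriting requires a single one.
  record Merged (x y : Vertex) (cs : List Cell) : Set where
    field
      merged   : Cell
      src-≡    : src merged ≡ x
      dst-≡    : dst merged ≡ y
      nodes-≡  : cellNodes merged ≡ concatMap cellNodes cs
      edges⁺   : ∀ {e} → Any (λ c → cellEdges c e) cs → cellEdges merged e
      edges⁻   : ∀ {e} → cellEdges merged e → Any (λ c → cellEdges c e) cs
      From⁺    : ∀ {p} → Any (λ c → p Subset.∈ From c) cs → p Subset.∈ From merged
      From⁻    : ∀ {p} → p Subset.∈ From merged → Any (λ c → p Subset.∈ From c) cs
      To⁺      : ∀ {p} → Any (λ c → p Subset.∈ To c) cs → p Subset.∈ To merged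

  merge : ∀ {x y} c cs → All (λ d → src d ≡ x × dst d ≡ y) (c ∷ cs) →
    AllPairs Apart (c ∷ cs) → Merged x y (c ∷ cs)
  merge c [] ((src≡ , dst≡) ∷ []) _ = record
    { merged  = c
    ; src-≡   = src≡
    ; dst-≡   = dst≡
    ; nodes-≡ = sym (++-identityʳ _)
    ; edges⁺  = λ { (here e) → e }
    ; edges⁻  = here
    ; From⁺   = λ { (here p∈) → p∈ }
    ; From⁻   = here
    ; To⁺     = λ { (here p∈) → p∈ }
    }
  merge c (d ∷ cs) ((refl , refl) ∷ ends) (c-apart ∷ apart)
    with merge d cs ends apart
  ... | record { merged = m ; src-≡ = refl ; dst-≡ = refl ; nodes-≡ = nodes-≡
               ; edges⁺ = edges⁺ ; edges⁻ = edges⁻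
               ; From⁺ = From⁺ ; From⁻ = From⁻ ; To⁺ = To⁺ } = record
    { merged  = record
        { src   = src c
        ; dst   = dst c
        ; reads = par disjoint (reads c) (reads m)
        ; From⊆ = λ p∈ → [ From⊆ c , From⊆ m ]′ (x∈p∪q⁻ (From c) _ p∈)
        ; To⊆   = λ p∈ → [ To⊆ c , To⊆ m ]′ (x∈p∪q⁻ (To c) _ p∈)
        }
    ; src-≡   = refl
    ; dst-≡   = refl
    ; nodes-≡ = cong (cellNodes c ++_) nodes-≡
    ; edges⁺  = λ { (here e) → inj₁ e ; (there es) → inj₂ (edges⁺ es) }
    ; edges⁻  = λ { (inj₁ e) → here e ; (inj₂ e) → there (edges⁻ e) }
    ; From⁺   = λ { (here p∈) → ∪-inˡ p∈ ; (there ps) → ∪-inʳ {S = From c} (From⁺ ps) }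
    ; From⁻   = λ p∈ → [ here , there ∘ From⁻ ]′ (x∈p∪q⁻ (From c) _ p∈)
    ; To⁺     = λ { (here p∈) → ∪-inˡ p∈ ; (there ps) → ∪-inʳ {S = To c} (To⁺ ps) }
    }
    where
    disjoint : From c # From m
    disjoint p∈c p∈m =
      let ((c#d , src≡ , _) , p∈d) = All.lookupAny (All.zip (c-apart , ends)) (From⁻ p∈m)
      in c#d (sym src≡) p∈c p∈d

  -- The `Any` argument witnesses that the list is not empty; there is no empty parallel
  -- composition.
  merge⁺ : ∀ {P : Cell → Set} {x y} cs → Any P cs →
    All (λ c → src c ≡ x × dst c ≡ y) cs → AllPairs Apart cs → Merged x y cs
  merge⁺ (c ∷ cs) _ = merge c cs

  -- Each edge of a graph reached by rewriting (Vertex, E₀) stands for some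
  -- cells, the contracted parts of the original graph.  The labels of the
  -- reached graph are ignored: since its edges form a set, two parallel parts
  -- with equal labels become one edge, which loses the multiplicity.
  module _ (E₀ : Pred (Vertex × Y × Vertex) 0ℓ) (start stop : Vertex) where

    record Tracks (G : Graph (Term Y)) : Set where
      field
        φ           : Fin (size G) → Vertex
        φ-injective : Injective φ
        φ-input     : φ (input G) ≡ start
        φ-output    : φ (output G) ≡ stop
        cells       : List Cell
        edge⇒cell   : ∀ {x t y} → edges G (x , t , y) →
                      Any (λ c → src c ≡ φ x × dst c ≡ φ y) cells
        cell⇒edge   : All (λ c → ∃[ x ] ∃[ t ] ∃[ y ]
                        (edges G (x , t , y) × src c ≡ φ x × dst c ≡ φ y)) cells
        -- Each vertex of the trace is either still present or inside exactly one cell.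
        nodes-↭     : tabulate φ ++ concatMap cellNodes cells ↭ tabulate id
        edges⁺      : ∀ {e} → E₀ e → Any (λ c → cellEdges c e) cells
        edges⁻      : ∀ {e} → Any (λ c → cellEdges c e) cells → E₀ e
        apart       : AllPairs Apart cells
        out-cover   : ∀ x {p} → p Subset.∈ outputPlaces (τ (φ x)) →
                      Any (λ c → src c ≡ φ x × p Subset.∈ From c) cells
        -- The input is exempt because it consumes the initial token, which no cell delivers.
        in-cover    : ∀ x {p} → x ≢ input G → p Subset.∈ inputs (τ (φ x)) →
                      Any (λ c → dst c ≡ φ x × p Subset.∈ To c) cells

    reorder : ∀ {G} (T : Tracks G) {cs} → Tracks.cells T ↭ cs → Tracks G
    reorder T {cs} p = record
      { φ           = φ
      ; φ-injective = φ-injective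
      ; φ-input     = φ-input
      ; φ-output    = φ-output
      ; cells       = cs
      ; edge⇒cell   = Any-resp-↭ p ∘ edge⇒cell
      ; cell⇒edge   = All-resp-↭ p cell⇒edge
      ; nodes-↭     = ↭-trans (++⁺ˡ (tabulate φ) (concatMap-↭ cellNodes (↭-sym p))) nodes-↭
      ; edges⁺      = Any-resp-↭ p ∘ edges⁺
      ; edges⁻      = edges⁻ ∘ Any-resp-↭ (↭-sym p)
      ; apart       = Permutation.AllPairs-resp-↭ (setoid Cell)
                        {R = Apart} (λ {c} {d} → Apart-sym c d) (≡.resp₂ Apart) (↭⇒↭ₛ p) apart
      ; out-cover   = λ x → Any-resp-↭ p ∘ out-cover x
      ; in-cover    = λ x x≢i → Any-resp-↭ p ∘ in-cover x x≢i
      }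
      where open Tracks T

    -- The rule does not change which pairs of vertices are joined, and the cells see nothing else
    -- of the edges.
    parallel-step : ∀ {n} {E : Edges (Term Y) n} {i o} x y u v (F : Edges (Term Y) n) →
      E ≐ F Pred.∪ ｛ x , u , y ｝ Pred.∪ ｛ x , v , y ｝ →
      Tracks (graph n E i o) → Tracks (graph n (F Pred.∪ ｛ x , u ∩ v , y ｝) i o)
    parallel-step x y u v F (E⊆ , ⊆E) T = record
      { φ           = φ
      ; φ-injective = φ-injective
      ; φ-input     = φ-input
      ; φ-output    = φ-output
      ; cells       = cells
      ; edge⇒cell   = λ { (inj₁ f)    → edge⇒cell (⊆E (inj₁ f))
                        ; (inj₂ refl) → edge⇒cell (⊆E (inj₂ (inj₁ refl))) }
      ; cell⇒edge   = All.map (λ (x , t , y , e , eqs) → keep eqs (E⊆ e)) cell⇒edge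
      ; nodes-↭     = nodes-↭
      ; edges⁺      = edges⁺
      ; edges⁻      = edges⁻
      ; apart       = apart
      ; out-cover   = out-cover
      ; in-cover    = in-cover
      }
      where
      open Tracks T
      keep : ∀ {A : _ → _ → Set} {p t q} → A p q →
        (F Pred.∪ ｛ x , u , y ｝ Pred.∪ ｛ x , v , y ｝) (p , t , q) →
        ∃[ p ] ∃[ t ] ∃[ q ] ((F Pred.∪ ｛ x , u ∩ v , y ｝) (p , t , q) × A p q)
      keep a (inj₁ f)           = _ , _ , _ , inj₁ f , a
      keep a (inj₂ (inj₁ refl)) = _ , _ , _ , inj₂ refl , a
      keep a (inj₂ (inj₂ refl)) = _ , _ , _ , inj₂ refl , a

    -- The cells fall into those entering `w` (`I`), those leaving it (`O`) and the rest (`R`). By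
    -- the side conditions all of `I` starts at `x` and all of `O` ends at `y`, so each group merges
    -- into one cell and `ser` joins the two at `φ w`.
    module Series {n} {E : Edges (Term Y) (suc n)} {i o} (w : Fin (suc n)) (x y : Fin n)
      (u v : Term Y) (w≢i : w ≢ i) (w≢o : w ≢ o)
      (ins : ∀ z t → E (z , t , w) ⇔ (z ≡ punchIn w x × t ≡ u))
      (outs : ∀ z t → E (w , t , z) ⇔ (z ≡ punchIn w y × t ≡ v))
      (T : Tracks (graph (suc n) E i o)) where

      private
        H : Graph (Term Y)
        H = graph n ((λ (p , t , q) → E (punchIn w p , t , punchIn w q))
                     Pred.∪ ｛ x , u · v , y ｝) (punchOut w≢i) (punchOut w≢o)

        open Tracks T using (φ; φ-injective)

        φ′ : Fin n → Vertex
        φ′ = φ ∘ punchIn w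

        φ′≢ : ∀ {z} → φ′ z ≢ φ w
        φ′≢ {z} = punchInᵢ≢i w z ∘ φ-injective

      module _ (I O R : List Cell) (cells↭ : Tracks.cells T ↭ I ++ O ++ R)
        (I-dst : All (λ c → dst c ≡ φ w) I) (O-src : All (λ c → src c ≡ φ w) O)
        (R-ends : All (λ c → src c ≢ φ w × dst c ≢ φ w) R) where

        private
          open Tracks (reorder T cells↭) hiding (φ; φ-injective; cells)

          parts : ∀ {P : Cell → Set} → Any P (I ++ O ++ R) → Any P I ⊎ Any P O ⊎ Any P R
          parts p = Sum.map₂ (Any.++⁻ O) (Any.++⁻ I p)

          I-ends : All (λ c → src c ≡ φ′ x × dst c ≡ φ w) I
          I-ends = All.map (λ {c} → ends {c}) (All.zip (I-dst , proj₁ (All.++⁻ I cell⇒edge)))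
            where
            ends : ∀ {c} → dst c ≡ φ w × ∃[ p ] ∃[ t ] ∃[ q ]
                     (E (p , t , q) × src c ≡ φ p × dst c ≡ φ q) →
                   src c ≡ φ′ x × dst c ≡ φ w
            ends (eq , p , t , q , e , src≡ , dst≡)
              with refl ← φ-injective (≡-trans (sym dst≡) eq)
              with refl , _ ← Equivalence.to (ins p t) e = src≡ , eq

          O-ends : All (λ c → src c ≡ φ w × dst c ≡ φ′ y) O
          O-ends = All.map (λ {c} → ends {c})
            (All.zip (O-src , proj₁ (All.++⁻ O (proj₂ (All.++⁻ I cell⇒edge)))))
            where
            ends : ∀ {c} → src c ≡ φ w × ∃[ p ] ∃[ t ] ∃[ q ]
                     (E (p , t , q) × src c ≡ φ p × dst c ≡ φ q) →
                   src c ≡ φ w × dst c ≡ φ′ y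
            ends (eq , p , t , q , e , src≡ , dst≡)
              with refl ← φ-injective (≡-trans (sym src≡) eq)
              with refl , _ ← Equivalence.to (outs q t) e = eq , dst≡

          apart-parts = AllPairs-++⁻ I apart
          I-apart  = proj₁ apart-parts
          I-others = proj₁ (proj₂ apart-parts)
          apart-parts′ = AllPairs-++⁻ O (proj₂ (proj₂ apart-parts))
          O-apart  = proj₁ apart-parts′
          R-apart  = proj₂ (proj₂ apart-parts′)

          into-w : ∀ {P : Cell → Set} → Any (λ c → dst c ≡ φ w × P c) (I ++ O ++ R) → Any P I
          into-w ps with parts ps
          ... | inj₁ p        = Any.map proj₂ p
          ... | inj₂ (inj₁ p) = ⊥-elim (All.lookupWith
            (λ (_ , eq) (eq′ , _) → φ′≢ (≡-trans (sym eq) eq′)) O-ends p)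
          ... | inj₂ (inj₂ p) = ⊥-elim (All.lookupWith (λ (_ , ≢w) (eq , _) → ≢w eq) R-ends p)

          out-of-w : ∀ {P : Cell → Set} → Any (λ c → src c ≡ φ w × P c) (I ++ O ++ R) → Any P O
          out-of-w ps with parts ps
          ... | inj₁ p        = ⊥-elim (All.lookupWith
            (λ (eq , _) (eq′ , _) → φ′≢ (≡-trans (sym eq) eq′)) I-ends p)
          ... | inj₂ (inj₁ p) = Any.map proj₂ p
          ... | inj₂ (inj₂ p) = ⊥-elim (All.lookupWith (λ (≢w , _) (eq , _) → ≢w eq) R-ends p)

          module I = Merged (merge⁺ I
            (into-w {P = λ _ → ⊤} (Any.map (λ (_ , eq) → eq , _)
              (edge⇒cell (Equivalence.from (ins _ _) (refl , refl)))))
            I-ends I-apart)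
          module O = Merged (merge⁺ O
            (out-of-w {P = λ _ → ⊤} (Any.map (λ (eq , _) → eq , _)
              (edge⇒cell (Equivalence.from (outs _ _) (refl , refl)))))
            O-ends O-apart)

          -- This is the exactness that `ser` demands. As `w` is not the input, each token it
          -- consumes arrives in a cell entering `w`, and all of these have been merged.
          To-I : To I.merged ≡ inputs (τ (φ w))
          To-I = ⊆-antisym
            (λ p∈ → subst (λ z → _ Subset.∈ inputs (τ z)) I.dst-≡ (To⊆ I.merged p∈))
            (λ p∈ → I.To⁺ (into-w (in-cover w w≢i p∈)))

          From-O : From O.merged ≡ outputPlaces (τ (φ w))
          From-O = ⊆-antisym
            (λ p∈ → subst (λ z → _ Subset.∈ outputPlaces (τ z)) O.src-≡ (From⊆ O.merged p∈))
            (λ p∈ → O.From⁺ (out-of-w (out-cover w p∈)))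

          new : Cell
          new = record
            { src   = src I.merged
            ; dst   = dst O.merged
            ; reads = ser (subst (Reads (τ (src I.merged)) (From I.merged) (term I.merged)) To-I
                             (reads I.merged)) (τ∈ (φ w))
                        (≡.subst₂ (λ z Q → Reads (τ z) Q (term O.merged) (To O.merged))
                          O.src-≡ From-O (reads O.merged))
            ; From⊆ = From⊆ I.merged
            ; To⊆   = To⊆ O.merged
            }

          punchIn-out : ∀ {z} (w≢z : w ≢ z) → φ′ (punchOut w≢z) ≡ φ z
          punchIn-out w≢z = cong φ (punchIn-punchOut w≢z)

        series-tracks : Tracks H
        series-tracks = record
          { φ           = φ′
          ; φ-injective = λ {z} {z′} → punchIn-injective w z z′ ∘ φ-injective
          ; φ-input     = ≡-trans (punchIn-out w≢i) φ-input
          ; φ-output    = ≡-trans (punchIn-out w≢o) φ-output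
          ; cells       = new ∷ R
          ; edge⇒cell   = λ { (inj₁ e)    → edge⇒cell′ (edge⇒cell e)
                            ; (inj₂ refl) → here (I.src-≡ , O.dst-≡) }
          ; cell⇒edge   = (_ , _ , _ , inj₂ refl , I.src-≡ , O.dst-≡) ∷
                          All.map (λ {c} (ends , p , t , q , e , eqs) → cell⇒edge′ {c} ends e eqs)
                            (All.zip (R-ends , proj₂ (All.++⁻ O (proj₂ (All.++⁻ I cell⇒edge)))))
          ; nodes-↭     = nodes-↭′
          ; edges⁺      = edges⁺′ ∘ edges⁺
          ; edges⁻      = edges⁻ ∘ edges⁻′
          ; apart       = All.tabulate (λ r∈ eq p∈I p∈R → new-apart (I.From⁻ p∈I) r∈ eq p∈R)
                          ∷ R-apart
          ; out-cover   = λ z p∈ → out-cover′ (out-cover (punchIn w z) p∈)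
          ; in-cover    = λ z z≢i p∈ → in-cover′ (in-cover (punchIn w z) (≢-input z≢i) p∈)
          }
          where
          edge⇒cell′ : ∀ {p q} → Any (λ c → src c ≡ φ′ p × dst c ≡ φ′ q) (I ++ O ++ R) →
            Any (λ c → src c ≡ φ′ p × dst c ≡ φ′ q) (new ∷ R)
          edge⇒cell′ ps with parts ps
          ... | inj₁ p        = ⊥-elim (All.lookupWith
            (λ (_ , eq) (_ , eq′) → φ′≢ (≡-trans (sym eq′) eq)) I-ends p)
          ... | inj₂ (inj₁ p) = ⊥-elim (All.lookupWith
            (λ (eq , _) (eq′ , _) → φ′≢ (≡-trans (sym eq′) eq)) O-ends p)
          ... | inj₂ (inj₂ p) = there p

          cell⇒edge′ : ∀ {c p t q} → src c ≢ φ w × dst c ≢ φ w → E (p , t , q) →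
            src c ≡ φ p × dst c ≡ φ q →
            ∃[ p ] ∃[ t ] ∃[ q ] (edges H (p , t , q) × src c ≡ φ′ p × dst c ≡ φ′ q)
          cell⇒edge′ {c} {p} {t} {q} (src≢ , dst≢) e (eq , eq′) =
            punchOut w≢p , t , punchOut w≢q ,
            inj₁ (≡.subst₂ (λ p q → E (p , t , q)) (sym (punchIn-punchOut w≢p))
                                                    (sym (punchIn-punchOut w≢q)) e) ,
            ≡-trans eq (sym (punchIn-out w≢p)) , ≡-trans eq′ (sym (punchIn-out w≢q))
            where
            w≢p : w ≢ p
            w≢p refl = src≢ eq
            w≢q : w ≢ q
            w≢q refl = dst≢ eq′

          nodes-↭′ : tabulate φ′ ++ concatMap cellNodes (new ∷ R) ↭ tabulate id
          nodes-↭′ = ↭-trans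
            (begin
              tabulate φ′ ++ (cellNodes I.merged ++ φ w ∷ cellNodes O.merged) ++ r
                ≡⟨ cong (tabulate φ′ ++_) (++-assoc (cellNodes I.merged) _ _) ⟩
              tabulate φ′ ++ cellNodes I.merged ++ φ w ∷ cellNodes O.merged ++ r
                ↭⟨ ++⁺ˡ (tabulate φ′) (shift (φ w) (cellNodes I.merged) _) ⟩
              tabulate φ′ ++ φ w ∷ cellNodes I.merged ++ cellNodes O.merged ++ r
                ↭⟨ shift (φ w) (tabulate φ′) _ ⟩
              φ w ∷ tabulate φ′ ++ cellNodes I.merged ++ cellNodes O.merged ++ r
                ↭⟨ ++⁺ʳ _ (↭-sym (tabulate-punchIn φ w)) ⟩
              tabulate φ ++ cellNodes I.merged ++ cellNodes O.merged ++ r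
                ≡⟨ cong₂ (λ is os → tabulate φ ++ is ++ os ++ r) I.nodes-≡ O.nodes-≡ ⟩
              tabulate φ ++ concatMap cellNodes I ++ concatMap cellNodes O ++ r
                ≡⟨ cong (λ zs → tabulate φ ++ concatMap cellNodes I ++ zs)
                        (sym (concatMap-++ cellNodes O R)) ⟩
              tabulate φ ++ concatMap cellNodes I ++ concatMap cellNodes (O ++ R)
                ≡⟨ cong (tabulate φ ++_) (sym (concatMap-++ cellNodes I (O ++ R))) ⟩
              tabulate φ ++ concatMap cellNodes (I ++ O ++ R) ∎)
            nodes-↭
            where
            open PermutationReasoning
            r = concatMap cellNodes R

          I-arrows : arrows (term I.merged) (src I.merged) (dst I.merged) ≡
                     arrows (term I.merged) (src I.merged) (φ w)
          I-arrows = cong (arrows (term I.merged) (src I.merged)) I.dst-≡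

          O-arrows : arrows (term O.merged) (src O.merged) (dst O.merged) ≡
                     arrows (term O.merged) (φ w) (dst O.merged)
          O-arrows = cong (λ z → arrows (term O.merged) z (dst O.merged)) O.src-≡

          edges⁺′ : ∀ {e} → Any (λ c → cellEdges c e) (I ++ O ++ R) →
            Any (λ c → cellEdges c e) (new ∷ R)
          edges⁺′ ps with parts ps
          ... | inj₁ p        = here (inj₁ (subst (λ P → P _) I-arrows (I.edges⁺ p)))
          ... | inj₂ (inj₁ p) = here (inj₂ (subst (λ P → P _) O-arrows (O.edges⁺ p)))
          ... | inj₂ (inj₂ p) = there p

          edges⁻′ : ∀ {e} → Any (λ c → cellEdges c e) (new ∷ R) →
            Any (λ c → cellEdges c e) (I ++ O ++ R)
          edges⁻′ (here (inj₁ p)) = Any.++⁺ˡ (I.edges⁻ (subst (λ P → P _) (sym I-arrows) p))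
          edges⁻′ (here (inj₂ p)) =
            Any.++⁺ʳ I (Any.++⁺ˡ (O.edges⁻ (subst (λ P → P _) (sym O-arrows) p)))
          edges⁻′ (there p)       = Any.++⁺ʳ I (Any.++⁺ʳ O p)

          new-apart : ∀ {p r} → Any (λ c → p Subset.∈ From c) I →
            r ∈ R → src I.merged ≡ src r → p Subset.∉ From r
          new-apart i r∈ eq p∈R =
            let ((c-apart , src≡ , _) , p∈c) = All.lookupAny (All.zip (I-others , I-ends)) i
            in All.lookup (proj₂ (All.++⁻ O c-apart)) r∈
                 (≡-trans src≡ (≡-trans (sym I.src-≡) eq)) p∈c p∈R

          out-cover′ : ∀ {z p} → Any (λ c → src c ≡ φ′ z × p Subset.∈ From c) (I ++ O ++ R) →
            Any (λ c → src c ≡ φ′ z × p Subset.∈ From c) (new ∷ R)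
          out-cover′ ps with parts ps
          ... | inj₁ p        =
            let ((src≡ , _) , eq , _) = All.lookupAny I-ends p
            in here (≡-trans I.src-≡ (≡-trans (sym src≡) eq) , I.From⁺ (Any.map proj₂ p))
          ... | inj₂ (inj₁ p) = ⊥-elim (All.lookupWith
            (λ (eq , _) (eq′ , _) → φ′≢ (≡-trans (sym eq′) eq)) O-ends p)
          ... | inj₂ (inj₂ p) = there p

          in-cover′ : ∀ {z p} → Any (λ c → dst c ≡ φ′ z × p Subset.∈ To c) (I ++ O ++ R) →
            Any (λ c → dst c ≡ φ′ z × p Subset.∈ To c) (new ∷ R)
          in-cover′ ps with parts ps
          ... | inj₁ p        = ⊥-elim (All.lookupWith
            (λ (_ , eq) (eq′ , _) → φ′≢ (≡-trans (sym eq′) eq)) I-ends p)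
          ... | inj₂ (inj₁ p) =
            let ((_ , dst≡) , eq , _) = All.lookupAny O-ends p
            in here (≡-trans O.dst-≡ (≡-trans (sym dst≡) eq) , O.To⁺ (Any.map proj₂ p))
          ... | inj₂ (inj₂ p) = there p

          ≢-input : ∀ {z} → z ≢ punchOut w≢i → punchIn w z ≢ i
          ≢-input {z} z≢ eq = z≢ (punchIn-injective w z _ (≡-trans eq (sym (punchIn-punchOut w≢i))))

      series-step : Tracks H
      series-step = series-tracks I O R
        (↭-trans (filter-↭ into? cells) (++⁺ˡ I (filter-↭ out? R′)))
        (All.all-filter into? cells) (All.all-filter out? R′)
        (All.zip (All.all-filter (¬? ∘ out?) R′ ,
                  All.filter⁺ (¬? ∘ out?) (All.all-filter (¬? ∘ into?) cells)))
        where
        open Tracks T using (cells)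
        into? : Decidable (λ c → dst c ≡ φ w)
        into? c = dst c ≟ φ w
        out? : Decidable (λ c → src c ≡ φ w)
        out? c = src c ≟ φ w
        I  = filter into? cells
        R′ = filter (¬? ∘ into?) cells
        O  = filter out? R′
        R  = filter (¬? ∘ out?) R′

    step : ∀ {G H} → G ⟶ H → Tracks G → Tracks H
    step (parallel x y u v F _ _ _ E≐)          T = parallel-step x y u v F E≐ T
    step (series w x y u v w≢i w≢o ins outs) T = Series.series-step w x y u v w≢i w≢o ins outs T

    steps⋆ : ∀ {G H} → Star _⟶_ G H → Tracks G → Tracks H
    steps⋆ ε        T = T
    steps⋆ (r ◅ rs) T = steps⋆ rs (step r T)

    record Parse : Set where
      field
        tree     : NTerm Y Vertex
        reads    : Reads (τ start) (outputPlaces (τ start)) tree (inputs (τ stop))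
        nodes-↭  : start ∷ stop ∷ nodes tree ↭ tabulate id
        arrows-≐ : E₀ ≐ arrows tree start stop

    -- All remaining cells run from `start` to `stop`. Merging them accounts for every token at both
    -- ends by the two covers; `in-cover` applies at the output since it differs from the input.
    single-edge : ∀ {H} → SingleEdge H → Tracks H → Parse
    single-edge {graph _ E i o} (refl , i≢o , t , E⊆ , ⊆E) T = record
      { tree     = term M.merged
      ; reads    = ≡.subst₂ (λ Q B → Reads (τ start) Q (term M.merged) B) From≡ To≡
                     (subst (λ z → Reads (τ z) (From M.merged) (term M.merged) (To M.merged))
                       M.src-≡ (reads M.merged))
      ; nodes-↭  = ↭-trans (++⁺ (ends i o φ i≢o φ-input φ-output) (↭-reflexive M.nodes-≡)) nodes-↭
      ; arrows-≐ = (λ {z} e → ≡.subst₂ (λ x y → arrows (term M.merged) x y z)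
                     M.src-≡ M.dst-≡ (M.edges⁺ (edges⁺ e)))
                 , (λ {z} e → edges⁻ (M.edges⁻ (≡.subst₂ (λ x y → arrows (term M.merged) x y z)
                     (sym M.src-≡) (sym M.dst-≡) e)))
      }
      where
      open Tracks T

      ends : ∀ (i o : Fin 2) (φ : Fin 2 → Vertex) → i ≢ o → φ i ≡ start → φ o ≡ stop →
        start ∷ stop ∷ [] ↭ tabulate φ
      ends zero       zero       φ i≢o _    _    = ⊥-elim (i≢o refl)
      ends zero       (suc zero) φ _   refl refl = ↭-refl
      ends (suc zero) zero       φ _   refl refl = swap _ _ ↭-refl
      ends (suc zero) (suc zero) φ i≢o _    _    = ⊥-elim (i≢o refl)

      cell-ends : All (λ c → src c ≡ start × dst c ≡ stop) cells
      cell-ends = All.map (λ {c} (p , t , q , e , eqs) → go {c} (E⊆ e) eqs) cell⇒edge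
        where
        go : ∀ {c : Cell} {p t′ q} → (i , t , o) ≡ (p , t′ , q) → src c ≡ φ p × dst c ≡ φ q →
          src c ≡ start × dst c ≡ stop
        go refl (eq , eq′) = ≡-trans eq φ-input , ≡-trans eq′ φ-output

      module M = Merged (merge⁺ cells (edge⇒cell (⊆E refl)) cell-ends apart)

      From≡ : From M.merged ≡ outputPlaces (τ start)
      From≡ = ⊆-antisym
        (λ p∈ → subst (λ z → _ Subset.∈ outputPlaces (τ z)) M.src-≡ (From⊆ M.merged p∈))
        (λ p∈ → M.From⁺ (Any.map proj₂
          (out-cover i (subst (λ z → _ Subset.∈ outputPlaces (τ z)) (sym φ-input) p∈))))

      To≡ : To M.merged ≡ inputs (τ stop)
      To≡ = ⊆-antisym
        (λ p∈ → subst (λ z → _ Subset.∈ inputs (τ z)) M.dst-≡ (To⊆ M.merged p∈))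
        (λ p∈ → M.To⁺ (Any.map proj₂
          (in-cover o (i≢o ∘ sym) (subst (λ z → _ Subset.∈ inputs (τ z)) (sym φ-output) p∈))))

-- The cells of an uncontracted trace

concatMap-[] : {f : A → List B} {xs : List A} → All (λ x → f x ≡ []) xs → concatMap f xs ≡ []
concatMap-[] []         = refl
concatMap-[] (eq ∷ eqs) = cong₂ _++_ eq (concatMap-[] eqs)

Link-functional : {ts : Vec (Transition Y n) k} → ∀ {p j l l′} →
  Link ts p j l → Link ts p j l′ → l ≡ l′
Link-functional {l = l} {l′} (j<l , p∈l , before-l) (j<l′ , p∈l′ , before-l′) with <-cmp l l′
... | tri< l<l′ _ _ = ⊥-elim (before-l′ l j<l l<l′ p∈l)
... | tri≈ _ eq _   = eq
... | tri> _ _ l>l′ = ⊥-elim (before-l l′ j<l′ l>l′ p∈l′)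

module _ {N : Net Y} where
  open Net N

  Run-∈ : ∀ {S S′} {ts : Vec _ k} → Run N S ts S′ → ∀ j → lookup ts j ∈ transitions
  Run-∈ ((t∈ , _) ∷ _) zero    = t∈
  Run-∈ (_ ∷ r)        (suc j) = Run-∈ r j

  Run-[] : ∀ {S S′} → Run N S [] S′ → S ≡ S′
  Run-[] [] = refl

  -- A nonempty subset of a singleton is the whole singleton.
  starts : ∀ {S} {ts : Vec _ (suc k)} → Run N ⁅ initial ⁆ ts S →
    inputs (lookup ts zero) ≡ ⁅ initial ⁆
  starts {ts = t ∷ _} ((_ , enabled) ∷ _) = ⊆-antisym enabled λ p∈ →
    let (q , q∈) = nonempty t
    in subst (Subset._∈ inputs t)
         (≡-trans (x∈⁅y⁆⇒x≡y _ (enabled q∈)) (sym (x∈⁅y⁆⇒x≡y _ p∈))) q∈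

  stops : ∀ {S} {ts : Vec _ (suc k)} → Run N S ts Subset.⊥ →
    outputPlaces (lookup ts (fromℕ k)) ≡ Subset.⊥
  stops {k = zero} {S} {t ∷ []} (_ ∷ r) = ⊆-antisym
    (λ p∈ → subst (_ Subset.∈_) (Run-[] r) (∪-inʳ {S = S Subset.─ inputs t} p∈)) ⊥⊆
  stops {k = suc _} {ts = _ ∷ _} (_ ∷ r) = stops r

module Atoms (N : Net Y) {k : ℕ} (ts : Vec (Transition Y (Net.places N)) (suc k))
  (run : Run N ⁅ Net.initial N ⁆ ts Subset.⊥) where
  open Net N
  open Reading N (lookup ts)
  open Rewriting N (lookup ts) (Run-∈ run)

  -- The part of a trace carried by the token that the transition j puts in p.
  record Atom (j : Vertex) (p : Fin places) : Set where
    field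
      cell    : Cell
      src-≡   : src cell ≡ j
      link    : Link ts p j (dst cell)
      From-≡  : From cell ≡ ⁅ p ⁆
      To-≡    : To cell ≡ ⁅ p ⁆
      nodes-≡ : cellNodes cell ≡ []
      edges⁺  : ∀ {a} → (a , p) ∈ outputs (lookup ts j) → cellEdges cell (j , a , dst cell)
      edges⁻  : ∀ {e} → cellEdges cell e →
                ∃[ a ] ((a , p) ∈ outputs (lookup ts j) × (j , a , dst cell) ≡ e)

  atomAt : ∀ j p → p Subset.∈ outputPlaces (lookup ts j) → Atom j p
  atomAt j p p∈ with consumer run j p∈ | labels (lookup ts j) p in eq
  -- Void: a place among the outputs has at least one label.
  ... | _ | [] =
    let (b , a∈) = ∈-outputPlaces⁻ (lookup ts j) p∈
    in ⊥-elim (¬∈[] (subst (b ∈_) eq (∈-labels⁺ (lookup ts j) a∈)))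
    where
    ¬∈[] : {a : Y} → a ∉ []
    ¬∈[] ()
  ... | l , link | a ∷ as = record
    { cell    = record
        { src   = j
        ; dst   = l
        ; reads = atom eq
        ; From⊆ = λ q∈ → subst (Subset._∈ _) (sym (x∈⁅y⁆⇒x≡y p q∈)) p∈
        ; To⊆   = λ q∈ → subst (Subset._∈ _) (sym (x∈⁅y⁆⇒x≡y p q∈)) (proj₁ (proj₂ link))
        }
    ; src-≡   = refl
    ; link    = link
    ; From-≡  = refl
    ; To-≡    = refl
    ; nodes-≡ = nodes-meet a as
    ; edges⁺  = λ b∈ → arrows-meet⁺ (subst (_ ∈_) eq (∈-labels⁺ (lookup ts j) b∈))
    ; edges⁻  = λ e → let (b , b∈ , b≡) = arrows-meet⁻ as e
                      in b , ∈-labels⁻ (lookup ts j) (subst (b ∈_) (sym eq) b∈) , b≡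
    }

  Tokens : Set
  Tokens = List (Vertex × Fin places)

  atoms : Tokens → List Cell
  atoms []             = []
  atoms ((j , p) ∷ xs) with p ∈? outputPlaces (lookup ts j)
  ... | yes p∈ = Atom.cell (atomAt j p p∈) ∷ atoms xs
  ... | no _   = atoms xs

  -- The premise ranges over every `Atom j p`, so that the membership proof picked by the decision
  -- procedure stays out of sight.
  atoms-All : ∀ xs {P : Cell → Set} →
    (∀ {j p} → (j , p) ∈ xs → (a : Atom j p) → P (Atom.cell a)) → All P (atoms xs)
  atoms-All []             f = []
  atoms-All ((j , p) ∷ xs) f with p ∈? outputPlaces (lookup ts j)
  ... | yes p∈ = f (here refl) (atomAt j p p∈) ∷ atoms-All xs (f ∘ there)
  ... | no _   = atoms-All xs (f ∘ there)

  atoms-Any : ∀ xs {P : Cell → Set} {j p} → (j , p) ∈ xs → p Subset.∈ outputPlaces (lookup ts j) →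
    ((a : Atom j p) → P (Atom.cell a)) → Any P (atoms xs)
  atoms-Any ((j , p) ∷ xs) i p∈ f with p ∈? outputPlaces (lookup ts j)
  atoms-Any ((j , p) ∷ xs) (here refl) p∈ f | yes p∈′ = here (f (atomAt j p p∈′))
  atoms-Any ((j , p) ∷ xs) (there i)   p∈ f | yes _   = there (atoms-Any xs i p∈ f)
  atoms-Any ((j , p) ∷ xs) (here refl) p∈ f | no p∉   = ⊥-elim (p∉ p∈)
  atoms-Any ((j , p) ∷ xs) (there i)   p∈ f | no _    = atoms-Any xs i p∈ f

  atoms-apart : ∀ {xs} → Unique xs → AllPairs Apart (atoms xs)
  atoms-apart []                       = []
  atoms-apart {(j , p) ∷ xs} (≢xs ∷ u) with p ∈? outputPlaces (lookup ts j)
  ... | no _   = atoms-apart u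
  ... | yes p∈ = atoms-All xs (λ i a → apart (atomAt j p p∈) a (All.lookup ≢xs i)) ∷ atoms-apart u
    where
    apart : ∀ {j p j′ p′} (a : Atom j p) (b : Atom j′ p′) → (j , p) ≢ (j′ , p′) →
      Apart (Atom.cell a) (Atom.cell b)
    apart {p = p} {p′ = p′} a b ≢ eq {q} q∈ q∈′ = ≢ (cong₂ _,_
      (≡-trans (sym (Atom.src-≡ a)) (≡-trans eq (Atom.src-≡ b)))
      (≡-trans (sym (x∈⁅y⁆⇒x≡y p (subst (q Subset.∈_) (Atom.From-≡ a) q∈)))
               (x∈⁅y⁆⇒x≡y p′ (subst (q Subset.∈_) (Atom.From-≡ b) q∈′))))

  tokens : Tokens
  tokens = cartesianProduct (allFin _) (allFin places)

  ∈-tokens : ∀ j p → (j , p) ∈ tokens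
  ∈-tokens j p = ∈-cartesianProduct⁺ (∈-allFin j) (∈-allFin p)

  initial-tracks : Tracks (traceEdges ts) zero (fromℕ k) (relabel letter (trace ts))
  initial-tracks = record
    { φ           = id
    ; φ-injective = id
    ; φ-input     = refl
    ; φ-output    = refl
    ; cells       = atoms tokens
    ; edge⇒cell   = λ { (j , a , l , (p , a∈ , link) , refl , refl , refl) →
        atoms-Any tokens (∈-tokens j p) (∈-outputPlaces⁺ (lookup ts j) a∈) λ c →
          Atom.src-≡ c , Link-functional {ts = ts} (Atom.link c) link }
    ; cell⇒edge   = atoms-All tokens λ {j} {p} _ c → cell⇒edge c
    ; nodes-↭     = ↭-reflexive (≡-trans
        (cong (tabulate id ++_) (concatMap-[] {xs = atoms tokens}
          (atoms-All tokens λ _ → Atom.nodes-≡)))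
        (++-identityʳ _))
    ; edges⁺      = λ { {j , a , l} (p , a∈ , link) →
        atoms-Any tokens (∈-tokens j p) (∈-outputPlaces⁺ (lookup ts j) a∈) λ c →
          subst (λ l → cellEdges (Atom.cell c) (j , a , l))
            (Link-functional {ts = ts} (Atom.link c) link) (Atom.edges⁺ c a∈) }
    ; edges⁻      = λ es → All.lookupWith (λ f → f) (atoms-All tokens λ _ c → edges⁻ c) es
    ; apart       = atoms-apart (Unique.cartesianProduct⁺ (Unique.allFin⁺ _) (Unique.allFin⁺ _))
    ; out-cover   = λ j {p} p∈ → atoms-Any tokens (∈-tokens j p) p∈ λ c →
        Atom.src-≡ c , subst (p Subset.∈_) (sym (Atom.From-≡ c)) (x∈⁅x⁆ p)
    ; in-cover    = in-cover
    }
    where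
    edges⁻ : ∀ {j p e} (c : Atom j p) → cellEdges (Atom.cell c) e → traceEdges ts e
    edges⁻ {p = p} c e with _ , a∈ , refl ← Atom.edges⁻ c e = p , a∈ , Atom.link c

    cell⇒edge : ∀ {j p} (c : Atom j p) → ∃[ x ] ∃[ t ] ∃[ y ]
      (edges (relabel letter (trace ts)) (x , t , y) ×
       src (Atom.cell c) ≡ x × dst (Atom.cell c) ≡ y)
    cell⇒edge {j} {p} c =
      let (a , a∈) = ∈-outputPlaces⁻ (lookup ts j)
            (subst (λ x → p Subset.∈ outputPlaces (lookup ts x)) (Atom.src-≡ c)
              (From⊆ (Atom.cell c) (subst (p Subset.∈_) (sym (Atom.From-≡ c)) (x∈⁅x⁆ p))))
      in j , letter a , dst (Atom.cell c) ,
         (j , a , _ , (p , a∈ , Atom.link c) , refl , refl , refl) , Atom.src-≡ c , refl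

    in-cover : ∀ l {p} → l ≢ zero → p Subset.∈ inputs (lookup ts l) →
      Any (λ c → dst c ≡ l × p Subset.∈ To c) (atoms tokens)
    in-cover zero        l≢0 p∈ = ⊥-elim (l≢0 refl)
    in-cover (suc l) {p} l≢0 p∈ with producer run (suc l) p∈
    -- The initial token is already consumed by the first transition, so it cannot last until
    -- `suc l`.
    ... | inj₁ (p∈ι , before) =
      ⊥-elim (before zero (s≤s z≤n) (subst (p Subset.∈_) (sym (starts run)) p∈ι))
    ... | inj₂ (j , p∈j , link) = atoms-Any tokens (∈-tokens j p) p∈j λ c →
      Link-functional {ts = ts} (Atom.link c) link ,
      subst (p Subset.∈_) (sym (Atom.To-≡ c)) (x∈⁅x⁆ p)

  series-parallel⇒Parse : SeriesParallel (trace ts) → Parse (traceEdges ts) zero (fromℕ k)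
  series-parallel⇒Parse (_ , steps , single) =
    single-edge _ _ _ single (steps⋆ _ _ _ steps initial-tracks)

-- The expression of an automaton and both inclusions

automatonExpr : Net Y → Expr Y
automatonExpr N =
  ⨆ transitions λ s → ⨆ transitions λ t →
  -- The first and the last transition of an accepting run satisfy these conditions. Nothing stands
  -- idle at the outset, so the depth bound starts at `places`.
  guard ((inputs s ≟ˢ ⁅ initial ⁆) ×-dec (outputPlaces t ≟ˢ Subset.⊥))
        (walks places s (outputPlaces s) (inputs t))
  where
  open Net N
  open Expressions N

automatonExpr-sound : (N : Net Y) → Safe N → 𝒢ₑ (automatonExpr N) ⊆ traces N
automatonExpr-sound N safe (u , u∈ , G≅u)
  with s , s∈ , u∈ ← ⨆⁻ (Net.transitions N) _ u∈
  with t , t∈ , u∈ ← ⨆⁻ (Net.transitions N) _ u∈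
  with (starts , stops) , u∈ ←
    guard⁻ ((inputs s ≟ˢ ⁅ Net.initial N ⁆) ×-dec (outputPlaces t ≟ˢ Subset.⊥)) _ u∈
  with v , refl , d ← Expressions.Soundness.walks-sound N (Net.places N) s _ _ u∈
  with k , ts , accepting , v≅ts ← Reads-id⇒traces N safe s∈ t∈ starts stops d =
  k , ts , accepting , ≅-trans G≅u v≅ts

-- The vertices of the parsed tree are positions in the run. Since `_≈_` keeps names and arrows, the
-- rebracketed term found in the expression still has the trace as its graph.
automatonExpr-complete : (N : Net Y) → Safe N → traces N ⊆ SeriesParallel →
  traces N ⊆ 𝒢ₑ (automatonExpr N)
automatonExpr-complete N safe sp (k , ts , run , G≅ts) =
  erase u , u∈′ , ≅-trans G≅ts (≅-sym (termGraph≅ u (trace ts) id id refl refl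
    (↭-trans (prep _ (prep _ (↭-sym (≈⇒↭ tree≈u)))) P.nodes-↭)
    λ p a q → mk⇔ (proj₁ (≈⇒≐ tree≈u _ _) ∘ proj₁ P.arrows-≐)
                  (proj₂ P.arrows-≐ ∘ proj₂ (≈⇒≐ tree≈u _ _))))
  where
  open Net N
  -- The parse is made of the trace itself, to which `G` is merely isomorphic.
  module P = Rewriting.Parse (Atoms.series-parallel⇒Parse N ts run (sp (k , ts , run , ≅-refl)))
  s = lookup ts zero
  t = lookup ts (fromℕ k)

  reachable : Reachable N (Subset.⊥ Subset.∪ outputPlaces s)
  reachable = subst (Reachable N) (fire-initial {N = N} s (starts run))
    (_ , _ , (Run-∈ run zero , subst (_ Subset.∈_) (starts run)) ∷ [])

  found : P.tree ∈≈ Expressions.walks N places s (outputPlaces s) (inputs t)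
  found = Completeness.Reads⇒walks N (lookup ts) safe P.reads reachable

  u = proj₁ found
  tree≈u = proj₁ (proj₂ found)

  u∈′ : terms (automatonExpr N) (erase u)
  u∈′ = ⨆⁺ _ (Run-∈ run zero) (⨆⁺ _ (Run-∈ run (fromℕ k))
    (guard⁺ ((inputs s ≟ˢ ⁅ initial ⁆) ×-dec (outputPlaces t ≟ˢ Subset.⊥)) _
      (starts run , stops run) (proj₂ (proj₂ found))))

theorem7p29 : (Y : Set) (𝒜 : PetriAutomaton Y) →
    ∃[ e ] (𝒢ₑ e ≐ 𝒢ₐ 𝒜)
theorem7p29 Y 𝒜 = automatonExpr net ,
  automatonExpr-sound net safe , automatonExpr-complete net safe seriesParallel
  where open PetriAutomaton 𝒜
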